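{- Let $\mathcal C\le\mathbb F_q^{n\times m}$ be a rank-metric code of dimension $k$ with associated rank function $\rho_{\mathcal C}$. (1) For every integer $0\le r\le k$ and every subspace $W\le E$, $$A^{(r)}_{\mathcal C}(W)=\sum_{J\le W}\mu(J,W)\begin{bmatrix}\rho_{\mathcal C}(E)-\rho_{\mathcal C}(J^\perp)\\ r\end{bmatrix}_q,$$ where $\mu(K,J)=(-1)^{\dim J-\dim K}q^{\binom{\dim J-\dim K}{2}}$ if $K\le J$ and $\mu(K,J)=0$ otherwise. In particular $\rho_{\mathcal C}$ determines the whole family $\{A^{(r)}_{\mathcal C}\}_{r=0}^k$. (2) Conversely, for every $J\le E$, $$\rho_{\mathcal C}(J)=\dim\mathcal C-\log_q\Bigl(1+(q-1)\sum_{W\le J^\perp}A^{(1)}_{\mathcal C}(W)\Bigr),$$ so $A^{(1)}_{\mathcal C}$ determines $\rho_{\mathcal C}$ uniquely. Consequently, the $(q,m)$-polymatroid $P_{\mathcal C}$ and the family $\{A^{(r)}_{\mathcal C}\}_{r=0}^{k}$ determine each other.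
   Context: $q$ prime power, $E=\mathbb F_q^n$, $\mathcal L(E)$ its subspaces. A rank-metric code is an $\mathbb F_q$-subspace $\mathcal C\le\mathbb F_q^{n\times m}$. For $M\in\mathcal C$, $\mathrm{supp}(M)$ is its column space; for a subcode $\mathcal D\le\mathcal C$, $\mathrm{Supp}(\mathcal D)=\sum_{M\in\mathcal D}\mathrm{supp}(M)$. For $J\le E$, $\mathcal C(J)=\{M\in\mathcal C\mid\mathrm{supp}(M)\subseteq J\}$, $J^\perp$ is the orthogonal complement for the standard dot product, and $\rho_{\mathcal C}(J)=\dim\mathcal C-\dim\mathcal C(J^\perp)$; $P_{\mathcal C}=(E,\rho_{\mathcal C})$. The $r$-th higher support distribution is $A^{(r)}_{\mathcal C}(W)=|\{\mathcal D\le\mathcal C\mid \dim\mathcal D=r,\ \mathrm{Supp}(\mathcal D)=W\}|$ for $W\le E$. The Gaussian coefficient is $\begin{bmatrix}a\\ b\end{bmatrix}_q=\prod_{i=0}^{b-1}\frac{q^{a-i}-1}{q^{b-i}-1}$ for $a\in\mathbb Z$, $b\in\mathbb Z_{\ge0}$ (and $0$ for $b<0$). -}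

module Defs where

open import Level using (0ℓ)
open import Function using (_∘_; const)
open import Data.Nat as ℕ using (ℕ; zero; suc; _∸_; _^_; _≡ᵇ_)
open import Data.Nat.Combinatorics using () renaming (_C_ to _choose_)
open import Data.Bool using (Bool; true; false; if_then_else_; _∧_; _∨_; not; T)
open import Data.List as L using (List; []; _∷_; length; concatMap; filterᵇ; upTo)
open import Data.Bool.ListAction using (and)
open import Data.List.Membership.Propositional using (_∈_)
open import Data.List.Relation.Unary.Unique.Propositional using (Unique)
open import Data.Vec as V using (Vec; []; _∷_)
open import Data.Vec.Properties using (≡-dec)
open import Data.Product using (Σ)
open import Data.Integer as ℤ using (ℤ; +_)
open import Relation.Binary.PropositionalEquality using (_≡_; _≢_)
open import Relation.Binary.Definitions using (DecidableEquality)
open import Relation.Nullary.Decidable using (⌊_⌋)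
open import Algebra.Structures using (IsCommutativeRing)

record FiniteField (q : ℕ) : Set₁ where
  infixl 6 _+_
  infixl 7 _*_
  field
    F        : Set
    _+_ _*_  : F → F → F
    -_       : F → F
    0# 1#    : F
    isCommutativeRing : IsCommutativeRing _≡_ _+_ _*_ -_ 0# 1#
    0≢1      : 0# ≢ 1#
    inverse  : (x : F) → x ≢ 0# → Σ F (λ y → x * y ≡ 1#)
    _≟_      : DecidableEquality F
    elements : List F
    complete : (x : F) → x ∈ elements
    unique   : Unique elements
    card     : length elements ≡ q

-- all predicates on a listed finite type (one per extensional class on xs)
preds : {A : Set} → DecidableEquality A → List A → List (A → Bool)
preds eq [] = const false ∷ []
preds eq (x ∷ xs) =
  concatMap (λ f → (λ y → if ⌊ eq y x ⌋ then true  else f y)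
                 ∷ (λ y → if ⌊ eq y x ⌋ then false else f y) ∷ [])
            (preds eq xs)

allᵇ : {A : Set} → (A → Bool) → List A → Bool
allᵇ p xs = and (L.map p xs)

prodℕ : List ℕ → ℕ
prodℕ = L.foldr ℕ._*_ 1

-- Gaussian coefficient [a over b]_q = ∏_{i<b} (q^(a-i) - 1)/(q^(b-i) - 1)
-- (a ≥ 0 here; the denominator is ≥ 1 for q ≥ 2, written suc (den ∸ 1)
-- only to make division total).
gauss : ℕ → ℕ → ℕ → ℕ
gauss q a b = num ℕ./ suc (den ∸ 1)
  where
  num = prodℕ (L.map (λ i → q ^ (a ∸ i) ∸ 1) (upTo b))
  den = prodℕ (L.map (λ i → q ^ (b ∸ i) ∸ 1) (upTo b))

-- discrete logarithm: least d ≤ c with q^d = c (used only for c = q^dim)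
logq : ℕ → ℕ → ℕ
logq q c = go c 0
  where
  go : ℕ → ℕ → ℕ
  go zero    d = d
  go (suc f) d = if (q ^ d) ≡ᵇ c then d else go f (suc d)

sumℤ : List ℤ → ℤ
sumℤ = L.foldr ℤ._+_ (+ 0)

sumℕ : List ℕ → ℕ
sumℕ = L.foldr ℕ._+_ 0

module RankMetric {q : ℕ} (𝔽 : FiniteField q) where
  open FiniteField 𝔽

  vecs : (n : ℕ) → List (Vec F n)
  vecs zero    = [] ∷ []
  vecs (suc n) = concatMap (λ x → L.map (x ∷_) (vecs n)) elements

  -- F_q^{n×m}: a matrix is stored as the Vec of its m columns in F_q^n
  Mat : ℕ → ℕ → Set
  Mat n m = Vec (Vec F n) m

  record FinSpace : Set₁ where
    field
      V     : Set
      eqV   : DecidableEquality V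
      elems : List V
      zeroV : V
      addV  : V → V → V
      smul  : F → V → V

  Fn : ℕ → FinSpace
  Fn n = record { V = Vec F n ; eqV = ≡-dec _≟_ ; elems = vecs n
                ; zeroV = V.replicate n 0# ; addV = V.zipWith _+_
                ; smul = λ c → V.map (c *_) }

  Fnm : ℕ → ℕ → FinSpace
  Fnm n m = record { V = Mat n m ; eqV = ≡-dec (≡-dec _≟_)
                   ; elems = vecs' m
                   ; zeroV = V.replicate m (V.replicate n 0#)
                   ; addV = V.zipWith (V.zipWith _+_)
                   ; smul = λ c → V.map (V.map (c *_)) }
    where
    vecs' : (k : ℕ) → List (Vec (Vec F n) k)
    vecs' zero    = [] ∷ []
    vecs' (suc k) = concatMap (λ x → L.map (x ∷_) (vecs' k)) (vecs n)

  module Sp (X : FinSpace) where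
    open FinSpace X

    isSubspace : (V → Bool) → Bool
    isSubspace S =
      S zeroV
      ∧ allᵇ (λ u → allᵇ (λ v → not (S u ∧ S v) ∨ S (addV u v)) elems) elems
      ∧ allᵇ (λ c → allᵇ (λ v → not (S v) ∨ S (smul c v)) elems) elements

    subspaces : List (V → Bool)
    subspaces = filterᵇ isSubspace (preds eqV elems)

    _⊆ᵇ_ : (V → Bool) → (V → Bool) → Bool
    S ⊆ᵇ T = allᵇ (λ v → not (S v) ∨ T v) elems

    _≐ᵇ_ : (V → Bool) → (V → Bool) → Bool
    S ≐ᵇ T = (S ⊆ᵇ T) ∧ (T ⊆ᵇ S)

    cardinality : (V → Bool) → ℕ
    cardinality S = length (filterᵇ S elems)

    dim : (V → Bool) → ℕ
    dim S = logq q (cardinality S)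

    subspacesOf : (V → Bool) → List (V → Bool)
    subspacesOf W = filterᵇ (_⊆ᵇ W) subspaces

  module _ (n m : ℕ) where
    open Sp (Fn n) public renaming
      (isSubspace to isSubspaceE; subspaces to subspacesE; _⊆ᵇ_ to _⊆E_;
       _≐ᵇ_ to _≐E_; dim to dimE; subspacesOf to subspacesOfE;
       cardinality to cardE)
    open Sp (Fnm n m) public renaming
      (isSubspace to isSubspaceM; subspaces to subspacesM; _⊆ᵇ_ to _⊆M_;
       _≐ᵇ_ to _≐M_; dim to dimM; subspacesOf to subspacesOfM;
       cardinality to cardM)

    Efull : Vec F n → Bool
    Efull _ = true

    dot : Vec F n → Vec F n → F
    dot u v = V.foldr _ _+_ 0# (V.zipWith _*_ u v)

    perp : (Vec F n → Bool) → (Vec F n → Bool)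
    perp J v = allᵇ (λ u → not (J u) ∨ ⌊ dot u v ≟ 0# ⌋) (vecs n)

    -- supp(M) ⊆ J  (column space of M contained in the subspace J)
    suppIn : Mat n m → (Vec F n → Bool) → Bool
    suppIn M J = allᵇ J (V.toList M)

    -- Supp(D) = Σ_{M ∈ D} supp(M): the smallest subspace of E containing
    -- supp(M) for every M ∈ D
    Supp : (Mat n m → Bool) → (Vec F n → Bool)
    Supp D v = allᵇ (λ S → not (allᵇ (λ M → not (D M) ∨ suppIn M S) (vecs'' m)) ∨ S v)
                     subspacesE
      where
      vecs'' : (k : ℕ) → List (Vec (Vec F n) k)
      vecs'' k = FinSpace.elems (Fnm n k)

    restrict : (Mat n m → Bool) → (Vec F n → Bool) → (Mat n m → Bool)
    restrict C J M = C M ∧ suppIn M J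

    ρ : (Mat n m → Bool) → (Vec F n → Bool) → ℕ
    ρ C J = dimM C ∸ dimM (restrict C (perp J))

    A : ℕ → (Mat n m → Bool) → (Vec F n → Bool) → ℕ
    A r C W = length (filterᵇ (λ D → (D ⊆M C) ∧ (dimM D ≡ᵇ r) ∧ (Supp D ≐E W))
                              subspacesM)

    -- μ(J,W) = (-1)^{dim W − dim J} q^{binom(dim W − dim J, 2)}  for J ≤ W
    μ : (Vec F n → Bool) → (Vec F n → Bool) → ℤ
    μ J W = sign d ℤ.* (+ (q ^ (d choose 2)))
      where
      d = dimE W ∸ dimE J
      sign : ℕ → ℤ
      sign zero    = + 1
      sign (suc k) = ℤ.- sign k

{-# OPTIONS --safe #-}

-- A subcode D of C lies in C(J) iff Supp(D) ≤ J, and ρ(E) − ρ(J⊥) = dim C(J) because J⊥⊥ = J. So both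
-- parts reduce to counting the subspaces of C(J) of a given dimension, and (1) moreover needs
-- Σ_{U ≤ J ≤ W} μ(J,W) = [U = W]. Both facts come from one induction step over a hyperplane H of W:
-- a subspace of W either lies in H, or is one of exactly q^(dim H − dim K) lifts of its intersection K
-- with H. This is the q-Pascal rule for the count, and it makes the Möbius sum vanish term by term,
-- since μ_{d+1} = −q^d μ_d.
module Submission where

open import Defs
open import Level using (0ℓ)
open import Algebra.Bundles using (Ring)
import Algebra.Properties.Ring as RingProperties
import Algebra.Properties.Group as GroupProperties
open import Algebra.Structures using (module IsCommutativeRing)
open import Data.Nat using (ℕ; zero; suc; _≤_; _<_; _∸_; _^_; _+_; _*_; _≡ᵇ_; _≤?_; s≤s; z≤n; NonZero; >-nonZero)
open import Data.Nat.Combinatorics using (nC1≡n; nCk+nC[k+1]≡[n+1]C[k+1]) renaming (_C_ to _choose_)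
open import Data.Nat.DivMod using (_/_; m*n/n≡m)
open import Data.Nat.Induction using (<-wellFounded)
import Data.Nat.Properties as ℕₚ
open import Data.Integer using (ℤ; +_; 0ℤ; 1ℤ; ∣_∣) renaming (_*_ to _*ℤ_; _+_ to _+ℤ_; -_ to -ℤ_; _-_ to _-ℤ_)
import Data.Integer.Properties as ℤₚ
open import Data.Integer.Tactic.RingSolver using (solve-∀)
open import Data.Bool using (Bool; true; false; T; not; _∧_; _∨_; if_then_else_)
open import Data.Bool.Properties using (T-∧; T-≡) renaming (_≟_ to _Bool≟_)
open import Data.List using (List; []; _∷_; map; length; concatMap; filterᵇ; upTo; applyUpTo; cartesianProductWith; _++_)
open import Data.List.Properties using (map-upTo)
open import Data.List.Membership.Propositional using (_∈_; find; lose)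
open import Data.List.Membership.Propositional.Properties using (∈-filter⁻; ∈-cartesianProductWith⁺)
open import Data.List.Relation.Unary.All as All using (All; []; _∷_)
open import Data.List.Relation.Unary.AllPairs using ([]; _∷_)
open import Data.List.Relation.Unary.Any as Any using (here; there)
open import Data.List.Relation.Unary.Unique.Propositional using (Unique)
open import Data.List.Relation.Unary.Unique.Propositional.Properties using (cartesianProductWith⁺)
open import Data.Vec as Vec using (Vec; []; _∷_)
import Data.Vec.Properties as Vecₚ
open import Data.Product using (_×_; _,_; proj₁; proj₂; ∃)
open import Data.Sum using (_⊎_; inj₁; inj₂)
open import Data.Empty using (⊥-elim)
open import Data.Unit using (tt)
open import Function using (_∘_; const; _⇔_; mk⇔; Equivalence)
open import Induction.WellFounded using (Acc; acc)
open import Relation.Binary.Definitions using (DecidableEquality; tri<; tri≈; tri>)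
open import Relation.Binary.PropositionalEquality
open import Relation.Nullary using (¬_; yes; no; contradiction)
open import Relation.Nullary.Decidable using (⌊_⌋; toWitness; fromWitness; T?; decidable-stable; ¬?; _×-dec_)

open Equivalence using (to; from)

-- Counts are therefore integer sums of indicators: a bijection becomes an exchange of two sums
-- followed by the collapse of an inner sum whose condition holds exactly once, and `subspaces-once`
-- provides that collapse up to extensional equality. No bases occur either. Dimension is the
-- logarithm of a cardinality, and the basic fact is |S + <a>| = q|S| for a outside S; even J⊥⊥ = J
-- is obtained by comparing cardinalities, from |J||J⊥| = |E|. The Gaussian coefficient is a
-- quotient of naturals, so the Pascal induction proves that count times denominator equals
-- numerator, and divides once at the end. The logarithm in (2) is stated exponentially: with d =
-- dim C(J⊥), it says that C(J⊥) has (q^d - 1)/(q - 1) lines.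

private variable
  Ω Ω′ : Set

-- Boolean tests and their propositional meaning

T-⇒ : ∀ {a b} → T (not a ∨ b) ⇔ (T a → T b)
T-⇒ {true}  = mk⇔ const (λ f → f tt)
T-⇒ {false} = mk⇔ (λ _ ()) (const tt)

T-allᵇ : {p : Ω → Bool} {xs : List Ω} → T (allᵇ p xs) ⇔ (∀ {x} → x ∈ xs → T (p x))
T-allᵇ {p = p} {xs} = mk⇔ (fwd xs) (bwd xs)
  where
  fwd : ∀ xs → T (allᵇ p xs) → ∀ {x} → x ∈ xs → T (p x)
  fwd (x ∷ xs) t (here refl) = proj₁ (to T-∧ t)
  fwd (x ∷ xs) t (there i)   = fwd xs (proj₂ (to T-∧ t)) i
  bwd : ∀ xs → (∀ {x} → x ∈ xs → T (p x)) → T (allᵇ p xs)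
  bwd []       _ = tt
  bwd (x ∷ xs) h = from T-∧ (h (here refl) , bwd xs (h ∘ there))

T-≡ᵇ : ∀ {a b : ℕ} → T (a ≡ᵇ b) ⇔ (a ≡ b)
T-≡ᵇ {a} {b} = mk⇔ (ℕₚ.≡ᵇ⇒≡ a b) (ℕₚ.≡⇒≡ᵇ a b)

-- Sums of indicators

𝟙 : Bool → ℤ
𝟙 b = if b then 1ℤ else 0ℤ

𝟙-cong : ∀ {a b} → (T a → T b) → (T b → T a) → 𝟙 a ≡ 𝟙 b
𝟙-cong {false} {false} _ _ = refl
𝟙-cong {false} {true}  _ g = ⊥-elim (g tt)
𝟙-cong {true}  {false} f _ = ⊥-elim (f tt)
𝟙-cong {true}  {true}  _ _ = refl

𝟙-∧ : ∀ a b → 𝟙 (a ∧ b) ≡ 𝟙 a *ℤ 𝟙 b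
𝟙-∧ true  b = sym (ℤₚ.*-identityˡ (𝟙 b))
𝟙-∧ false b = refl

𝟙-diff : ∀ a b → 𝟙 (a ∧ not b) ≡ 𝟙 a -ℤ 𝟙 (a ∧ b)
𝟙-diff true  true  = refl
𝟙-diff true  false = refl
𝟙-diff false _     = refl

𝟙-true : ∀ {a} → T a → 𝟙 a ≡ 1ℤ
𝟙-true {true} _ = refl

𝟙-false : ∀ {a} → ¬ T a → 𝟙 a ≡ 0ℤ
𝟙-false {true}  h = ⊥-elim (h tt)
𝟙-false {false} _ = refl

-- Allows a summand to be rewritten under the assumption that its indicator is true; when it is
-- false, both products are 0.
𝟙-guard : ∀ a x y → (T a → x ≡ y) → 𝟙 a *ℤ x ≡ 𝟙 a *ℤ y
𝟙-guard true  x y h = cong (1ℤ *ℤ_) (h tt)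
𝟙-guard false x y h = refl

∑ : List Ω → (Ω → ℤ) → ℤ
∑ xs f = sumℤ (map f xs)

∑-cong : ∀ (xs : List Ω) {f g} → (∀ {x} → x ∈ xs → f x ≡ g x) → ∑ xs f ≡ ∑ xs g
∑-cong []       _ = refl
∑-cong (x ∷ xs) h = cong₂ _+ℤ_ (h (here refl)) (∑-cong xs (h ∘ there))

∑-0 : (xs : List Ω) → ∑ xs (const 0ℤ) ≡ 0ℤ
∑-0 []       = refl
∑-0 (x ∷ xs) = trans (ℤₚ.+-identityˡ _) (∑-0 xs)

∑-+ : ∀ (xs : List Ω) f g → ∑ xs (λ x → f x +ℤ g x) ≡ ∑ xs f +ℤ ∑ xs g
∑-+ []       f g = refl
∑-+ (x ∷ xs) f g = trans (cong (f x +ℤ g x +ℤ_) (∑-+ xs f g)) (interchange (f x) (g x) _ _)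
  where
  interchange : ∀ a b c d → a +ℤ b +ℤ (c +ℤ d) ≡ a +ℤ c +ℤ (b +ℤ d)
  interchange = solve-∀

∑-*ˡ : ∀ (xs : List Ω) c f → ∑ xs (λ x → c *ℤ f x) ≡ c *ℤ ∑ xs f
∑-*ˡ []       c f = sym (ℤₚ.*-zeroʳ c)
∑-*ˡ (x ∷ xs) c f = trans (cong (c *ℤ f x +ℤ_) (∑-*ˡ xs c f)) (sym (ℤₚ.*-distribˡ-+ c (f x) _))

∑-*ʳ : ∀ (xs : List Ω) f c → ∑ xs (λ x → f x *ℤ c) ≡ ∑ xs f *ℤ c
∑-*ʳ xs f c = trans (∑-cong xs (λ {x} _ → ℤₚ.*-comm (f x) c))
                (trans (∑-*ˡ xs c f) (ℤₚ.*-comm c _))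

∑-diff : ∀ (xs : List Ω) f g → ∑ xs (λ x → f x -ℤ g x) ≡ ∑ xs f -ℤ ∑ xs g
∑-diff xs f g = trans (∑-+ xs f (-ℤ_ ∘ g)) (cong (∑ xs f +ℤ_) neg)
  where
  neg : ∑ xs (-ℤ_ ∘ g) ≡ -ℤ ∑ xs g
  neg = trans (∑-cong xs (λ {x} _ → sym (ℤₚ.-1*i≡-i (g x))))
          (trans (∑-*ˡ xs (-ℤ 1ℤ) g) (ℤₚ.-1*i≡-i _))

∑-const : (xs : List Ω) (c : ℤ) → ∑ xs (const c) ≡ + length xs *ℤ c
∑-const []       c = refl
∑-const (x ∷ xs) c = trans (cong (c +ℤ_) (∑-const xs c)) (sym (ℤₚ.suc-* (+ length xs) c))

∑-swap : ∀ (xs : List Ω) (ys : List Ω′) (f : Ω → Ω′ → ℤ)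
       → ∑ xs (λ x → ∑ ys (f x)) ≡ ∑ ys (λ y → ∑ xs (λ x → f x y))
∑-swap []       ys f = sym (∑-0 ys)
∑-swap (x ∷ xs) ys f = trans (cong (∑ ys (f x) +ℤ_) (∑-swap xs ys f)) (sym (∑-+ ys (f x) _))

∑-++ : ∀ (xs ys : List Ω) f → ∑ (xs ++ ys) f ≡ ∑ xs f +ℤ ∑ ys f
∑-++ []       ys f = sym (ℤₚ.+-identityˡ _)
∑-++ (x ∷ xs) ys f = trans (cong (f x +ℤ_) (∑-++ xs ys f)) (sym (ℤₚ.+-assoc (f x) _ _))

∑-concatMap : ∀ (xs : List Ω) (k : Ω → List Ω′) f → ∑ (concatMap k xs) f ≡ ∑ xs (λ x → ∑ (k x) f)
∑-concatMap []       k f = refl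
∑-concatMap (x ∷ xs) k f = trans (∑-++ (k x) _ f) (cong (∑ (k x) f +ℤ_) (∑-concatMap xs k f))

∑-filterᵇ : ∀ (p : Ω → Bool) xs f → ∑ (filterᵇ p xs) f ≡ ∑ xs (λ x → 𝟙 (p x) *ℤ f x)
∑-filterᵇ p []       f = refl
∑-filterᵇ p (x ∷ xs) f with p x
... | true  = cong₂ _+ℤ_ (sym (ℤₚ.*-identityˡ (f x))) (∑-filterᵇ p xs f)
... | false = trans (∑-filterᵇ p xs f) (sym (ℤₚ.+-identityˡ _))

length-filterᵇ : ∀ (p : Ω → Bool) xs → + length (filterᵇ p xs) ≡ ∑ xs (𝟙 ∘ p)
length-filterᵇ p []       = refl
length-filterᵇ p (x ∷ xs) with p x
... | true  = cong (1ℤ +ℤ_) (length-filterᵇ p xs)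
... | false = trans (length-filterᵇ p xs) (sym (ℤₚ.+-identityˡ _))

∑-false : ∀ (xs : List Ω) (p : Ω → Bool) → (∀ {x} → x ∈ xs → ¬ T (p x)) → ∑ xs (𝟙 ∘ p) ≡ 0ℤ
∑-false xs p h = trans (∑-cong xs (λ i → 𝟙-false (h i))) (∑-0 xs)

∑-≟ : (_≟_ : DecidableEquality Ω) {xs : List Ω} → Unique xs → ∀ {x} → x ∈ xs
    → ∑ xs (λ y → 𝟙 ⌊ y ≟ x ⌋) ≡ 1ℤ
∑-≟ _≟_ {y ∷ ys} (y∉ ∷ u) {x} (here refl) =
  cong₂ _+ℤ_ (𝟙-true (fromWitness {a? = y ≟ y} refl))
    (∑-false ys (λ z → ⌊ z ≟ x ⌋) (λ i t → All.lookup y∉ i (sym (toWitness t))))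
∑-≟ _≟_ {y ∷ ys} (y∉ ∷ u) {x} (there i) =
  cong₂ _+ℤ_ (𝟙-false {⌊ y ≟ x ⌋} (λ t → All.lookup y∉ i (toWitness t))) (∑-≟ _≟_ u i)

-- Stands in for a bijection: if `p` holds exactly once along the list, the sum is the value at that
-- place. The value is prescribed only where `p` holds, so any listed representative of a subspace
-- will do.
∑-once : ∀ (xs : List Ω) (p : Ω → Bool) (f : Ω → ℤ) {c} → ∑ xs (𝟙 ∘ p) ≡ 1ℤ
       → (∀ {x} → x ∈ xs → T (p x) → f x ≡ c) → ∑ xs (λ x → 𝟙 (p x) *ℤ f x) ≡ c
∑-once xs p f {c} once h = begin
  ∑ xs (λ x → 𝟙 (p x) *ℤ f x) ≡⟨ ∑-cong xs (λ {x} i → 𝟙-guard (p x) (f x) c (h i)) ⟩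
  ∑ xs (λ x → 𝟙 (p x) *ℤ c)   ≡⟨ ∑-*ʳ xs (𝟙 ∘ p) c ⟩
  ∑ xs (𝟙 ∘ p) *ℤ c           ≡⟨ cong (_*ℤ c) once ⟩
  1ℤ *ℤ c                     ≡⟨ ℤₚ.*-identityˡ c ⟩
  c ∎
  where open ≡-Reasoning

∑-exists : ∀ (xs : List Ω) (p : Ω → Bool) → ∑ xs (𝟙 ∘ p) ≢ 0ℤ → ∃ λ x → x ∈ xs × T (p x)
∑-exists xs p h with Any.any? (λ x → T? (p x)) xs
... | yes i = let (x , x∈ , px) = find i in x , x∈ , px
... | no ¬i = contradiction (∑-false xs p (λ x∈ px → ¬i (lose x∈ px))) h

module _ (p r : Ω → Bool) where

  count-mono : ∀ xs → (∀ {x} → T (p x) → T (r x)) → length (filterᵇ p xs) ≤ length (filterᵇ r xs)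
  count-mono []       h = z≤n
  count-mono (x ∷ xs) h with p x | r x | h {x}
  ... | true  | true  | _ = s≤s (count-mono xs h)
  ... | true  | false | f = ⊥-elim (f tt)
  ... | false | true  | _ = ℕₚ.m≤n⇒m≤1+n (count-mono xs h)
  ... | false | false | _ = count-mono xs h

  -- An element on which the predicates differ makes the count strict. Hence inclusion without
  -- growth is equality, and cardinality can serve as the measure in recursions over hyperplanes.
  count-mono-< : ∀ {xs y} → (∀ {x} → T (p x) → T (r x)) → y ∈ xs → ¬ T (p y) → T (r y)
               → length (filterᵇ p xs) < length (filterᵇ r xs)
  count-mono-< {x ∷ xs} h (here refl) ¬py ry with p x | r x
  ... | false | true = s≤s (count-mono xs h)
  ... | true  | _    = ⊥-elim (¬py tt)
  count-mono-< {x ∷ xs} h (there i) ¬py ry with p x | r x | h {x}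
  ... | true  | true  | _ = s≤s (count-mono-< h i ¬py ry)
  ... | true  | false | f = ⊥-elim (f tt)
  ... | false | true  | _ = ℕₚ.m<n⇒m<1+n (count-mono-< h i ¬py ry)
  ... | false | false | _ = count-mono-< h i ¬py ry

-- Predicates on a listed type

module _ (_≟_ : DecidableEquality Ω) where

  agree : (S f : Ω → Bool) → List Ω → Bool
  agree S f = allᵇ (λ y → ⌊ f y Bool≟ S y ⌋)

  private
    extend : Ω → Bool → (Ω → Bool) → Ω → Bool
    extend x b f y = if ⌊ y ≟ x ⌋ then b else f y

  -- Of the two ways to extend a predicate to `x`, exactly one takes the value of `S` there. As `x`
  -- does not recur in `xs`, the extension leaves the values on the tail alone, so the count is
  -- inherited.
  preds-once : ∀ {xs} → Unique xs → ∀ S → ∑ (preds _≟_ xs) (λ f → 𝟙 (agree S f xs)) ≡ 1ℤ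
  preds-once {[]}     _        S = refl
  preds-once {x ∷ xs} (x∉ ∷ u) S = begin
    ∑ (preds _≟_ (x ∷ xs)) (λ f → 𝟙 (agree S f (x ∷ xs)))
      ≡⟨ ∑-concatMap (preds _≟_ xs) _ (λ f → 𝟙 (agree S f (x ∷ xs))) ⟩
    ∑ (preds _≟_ xs) (λ f → 𝟙 (agree S (extend x true f) (x ∷ xs)) +ℤ (𝟙 (agree S (extend x false f) (x ∷ xs)) +ℤ 0ℤ))
      ≡⟨ ∑-cong (preds _≟_ xs) (λ {f} _ → one f) ⟩
    ∑ (preds _≟_ xs) (λ f → 𝟙 (agree S f xs))
      ≡⟨ preds-once u S ⟩
    1ℤ ∎
    where
    open ≡-Reasoning
    at-x : ∀ b f → extend x b f x ≡ b
    at-x b f with x ≟ x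
    ... | yes _ = refl
    ... | no ¬e = contradiction refl ¬e
    off-x : ∀ b f {y} → y ∈ xs → extend x b f y ≡ f y
    off-x b f {y} i with y ≟ x
    ... | yes e = contradiction (sym e) (All.lookup x∉ i)
    ... | no _  = refl
    rest : ∀ b f → agree S (extend x b f) (x ∷ xs) ≡ ⌊ b Bool≟ S x ⌋ ∧ agree S f xs
    rest b f = cong₂ _∧_ (cong (λ z → ⌊ z Bool≟ S x ⌋) (at-x b f))
                 (go xs (λ i → off-x b f i))
      where
      go : ∀ ys → (∀ {y} → y ∈ ys → extend x b f y ≡ f y) → agree S (extend x b f) ys ≡ agree S f ys
      go []       h = refl
      go (y ∷ ys) h = cong₂ _∧_ (cong (λ z → ⌊ z Bool≟ S y ⌋) (h (here refl))) (go ys (h ∘ there))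
    one : ∀ f → 𝟙 (agree S (extend x true f) (x ∷ xs)) +ℤ (𝟙 (agree S (extend x false f) (x ∷ xs)) +ℤ 0ℤ)
        ≡ 𝟙 (agree S f xs)
    one f rewrite rest true f | rest false f with S x | agree S f xs
    ... | true  | true  = refl
    ... | true  | false = refl
    ... | false | true  = refl
    ... | false | false = refl

T-not : ∀ {b} → T (not b) ⇔ (¬ T b)
T-not {true}  = mk⇔ ⊥-elim (λ h → h tt)
T-not {false} = mk⇔ (λ _ ()) (const tt)

-- Powers of q and the discrete logarithm

^-injective : ∀ {q} → 1 < q → ∀ m n → q ^ m ≡ q ^ n → m ≡ n
^-injective {q} 1<q m n eq with ℕₚ.<-cmp m n
... | tri< m<n _ _ = contradiction eq (ℕₚ.<⇒≢ (ℕₚ.^-monoʳ-< q 1<q m<n))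
... | tri≈ _ m≡n _ = m≡n
... | tri> _ _ n<m = contradiction (sym eq) (ℕₚ.<⇒≢ (ℕₚ.^-monoʳ-< q 1<q n<m))

-- The search inside logq is local to Defs; unification recovers it.
mutual
  search : ℕ → ℕ → ℕ → ℕ → ℕ
  search = _

  logq-search : ∀ q c → logq q (suc c) ≡ (if 1 ≡ᵇ suc c then 0 else search q (suc c) c 1)
  logq-search q c with suc c | 1
  ... | _ | _ = refl

-- The invariant d ≤ e < d + f says that the search has not passed the exponent and that the fuel
-- still reaches it.
search-^ : ∀ {q} → 1 < q → ∀ f d e → d ≤ e → e < d + f → search q (q ^ e) f d ≡ e
search-^ {q} 1<q zero    d e d≤e e<d = contradiction (subst (e <_) (ℕₚ.+-identityʳ d) e<d) (ℕₚ.≤⇒≯ d≤e)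
search-^ {q} 1<q (suc f) d e d≤e e<d+f with (q ^ d) ≡ᵇ (q ^ e) in eq
... | true  = ^-injective 1<q d e (to T-≡ᵇ (from T-≡ eq))
... | false = search-^ 1<q f (suc d) e (ℕₚ.≤∧≢⇒< d≤e d≢e) (subst (e <_) (ℕₚ.+-suc d f) e<d+f)
  where
  d≢e : d ≢ e
  d≢e refl = subst T eq (from (T-≡ᵇ {q ^ d}) refl)

-- The fuel of the search for the logarithm of q^e is q^e itself, and this bound shows that it
-- suffices to reach e.
n<q^n : ∀ {q} → 1 < q → ∀ n → n < q ^ n
n<q^n 1<q zero    = s≤s z≤n
n<q^n {q} 1<q (suc n) = ℕₚ.<-≤-trans (s≤s (n<q^n 1<q n)) (ℕₚ.^-monoʳ-< q 1<q (ℕₚ.n<1+n n))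

logq≡search : ∀ q c → logq q c ≡ search q c c 0
logq≡search q zero    = refl
logq≡search q (suc c) = refl

logq-^ : ∀ {q} → 1 < q → ∀ e → logq q (q ^ e) ≡ e
logq-^ {q} 1<q e = trans (logq≡search q (q ^ e)) (search-^ 1<q (q ^ e) 0 e z≤n (n<q^n 1<q e))

-- Gaussian coefficients

-- The product of q^(a-i) - 1 for i < b, taken from the front: the numerator of the Gaussian
-- coefficient. The case a = b is its denominator.
gaussProd : ℕ → ℕ → ℕ → ℕ
gaussProd q a zero    = 1
gaussProd q a (suc b) = (q ^ a ∸ 1) * gaussProd q (a ∸ 1) b

prodℕ-gaussProd : ∀ q a b → prodℕ (applyUpTo (λ i → q ^ (a ∸ i) ∸ 1) b) ≡ gaussProd q a b
prodℕ-gaussProd q a       zero    = refl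
prodℕ-gaussProd q zero    (suc b) = refl
prodℕ-gaussProd q (suc a) (suc b) = cong ((q ^ suc a ∸ 1) *_) (prodℕ-gaussProd q a b)

-- The recursion splits off the first factor, whereas the Pascal induction keeps a and lengthens the
-- product at its far end.
gaussProd-suc : ∀ q a b → gaussProd q a (suc b) ≡ gaussProd q a b * (q ^ (a ∸ b) ∸ 1)
gaussProd-suc q a       zero    = ℕₚ.*-comm (q ^ a ∸ 1) 1
gaussProd-suc q zero    (suc b) = refl
gaussProd-suc q (suc a) (suc b) =
  trans (cong ((q ^ suc a ∸ 1) *_) (gaussProd-suc q a b)) (sym (ℕₚ.*-assoc (q ^ suc a ∸ 1) (gaussProd q a b) _))

-- Once the exponent has come down to 0, the factor q^0 - 1 vanishes; so truncated subtraction still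
-- gives the value 0 for b > a.
gaussProd-< : ∀ q {a b} → a < b → gaussProd q a b ≡ 0
gaussProd-< q {zero}  {suc b} _         = refl
gaussProd-< q {suc a} {suc b} (s≤s a<b) = trans (cong ((q ^ suc a ∸ 1) *_) (gaussProd-< q a<b)) (ℕₚ.*-zeroʳ (q ^ suc a ∸ 1))

gaussProd-pos : ∀ {q} → 1 < q → ∀ r → 0 < gaussProd q r r
gaussProd-pos     1<q zero    = s≤s z≤n
gaussProd-pos {q} 1<q (suc r) = ℕₚ.*-mono-< (ℕₚ.m<n⇒0<n∸m (ℕₚ.^-monoʳ-< q 1<q {0} {suc r} (s≤s z≤n))) (gaussProd-pos 1<q r)

-- The denominator is positive, so the `suc (den ∸ 1)` in `gauss` is the denominator itself, and
-- exact divisibility decides the quotient.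
gauss-unique : ∀ {q} → 1 < q → ∀ a b n → n * gaussProd q b b ≡ gaussProd q a b → gauss q a b ≡ n
gauss-unique {q} 1<q a b n e = begin
  gauss q a b
    ≡⟨ cong₂ (λ x y → x / suc (y ∸ 1)) (trans (prods a) (sym e)) (prods b) ⟩
  (n * gaussProd q b b) / suc (gaussProd q b b ∸ 1)
    ≡⟨ cong (λ z → (n * z) / suc (gaussProd q b b ∸ 1)) (ℕₚ.m+[n∸m]≡n (gaussProd-pos 1<q b)) ⟨
  (n * suc (gaussProd q b b ∸ 1)) / suc (gaussProd q b b ∸ 1)
    ≡⟨ m*n/n≡m n (suc (gaussProd q b b ∸ 1)) ⟩
  n ∎
  where
  open ≡-Reasoning
  prods : ∀ a → prodℕ (map (λ i → q ^ (a ∸ i) ∸ 1) (upTo b)) ≡ gaussProd q a b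
  prods a = trans (cong prodℕ (map-upTo (λ i → q ^ (a ∸ i) ∸ 1) b)) (prodℕ-gaussProd q a b)

-- (-1)^d q^(d choose 2) in recursive form, the shape in which consecutive values cancel; `μ≡möbius`
-- links it to the closed form.
möbius : ℕ → ℕ → ℤ
möbius q zero    = 1ℤ
möbius q (suc d) = -ℤ (+ (q ^ d) *ℤ möbius q d)

+[m∸n] : ∀ {m n} → n ≤ m → + (m ∸ n) ≡ + m -ℤ + n
+[m∸n] {m} {n} n≤m = sym (trans (ℤₚ.m-n≡m⊖n m n) (ℤₚ.⊖-≥ n≤m))

-- Finite vector spaces

module FieldTheory {q : ℕ} (𝔽 : FiniteField q) where
  open FiniteField 𝔽 public
    using (F; elements; card; 0#; 1#; 0≢1; inverse)
    renaming (complete to completeF; unique to uniqueF; _≟_ to _≟F_; _+_ to _+F_; _*_ to _*F_; -_ to -F_)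
  open IsCommutativeRing (FiniteField.isCommutativeRing 𝔽) public using () renaming
    (+-assoc to +F-assoc; +-comm to +F-comm; +-identityʳ to +F-identityʳ; -‿inverseʳ to -F-inverseʳ; -‿inverseˡ to -F-inverseˡ
    ; *-assoc to *F-assoc; *-comm to *F-comm; *-identityˡ to *F-identityˡ; *-identityʳ to *F-identityʳ
    ; distribˡ to *F-distribˡ; distribʳ to *F-distribʳ; zeroˡ to *F-zeroˡ; zeroʳ to *F-zeroʳ)

  ringF : Ring 0ℓ 0ℓ
  ringF = record { isRing = IsCommutativeRing.isRing (FiniteField.isCommutativeRing 𝔽) }

  open RingProperties ringF using (-1*x≈-x)
  open GroupProperties (Ring.+-group ringF) using (x∙y⁻¹≈ε⇒x≈y)

  1<q : 1 < q
  1<q = subst (1 <_) card (two elements (completeF 0#) (completeF 1#))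
    where
    two : ∀ xs → 0# ∈ xs → 1# ∈ xs → 1 < length xs
    two (_ ∷ [])     (here e) (here e′) = contradiction (trans e (sym e′)) 0≢1
    two (_ ∷ _ ∷ xs) _        _         = s≤s (s≤s z≤n)

  instance
    q-nonZero : NonZero q
    q-nonZero = >-nonZero (ℕₚ.<-trans (s≤s z≤n) 1<q)

  open RankMetric 𝔽 using (FinSpace; module Sp)

  -- Negation is scaling by `-F 1#`, so no inverse law is listed; `smul-zeroˡ` provides the
  -- cancellation. The enumeration belongs to the structure because dimensions are read off from
  -- counts.
  record IsVectorSpace (X : FinSpace) : Set where
    open FinSpace X
    field
      add-assoc     : ∀ u v w → addV (addV u v) w ≡ addV u (addV v w)
      add-comm      : ∀ u v → addV u v ≡ addV v u
      add-identityʳ : ∀ u → addV u zeroV ≡ u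
      smul-distribˡ : ∀ c u v → smul c (addV u v) ≡ addV (smul c u) (smul c v)
      smul-distribʳ : ∀ c d u → smul (c +F d) u ≡ addV (smul c u) (smul d u)
      smul-assoc    : ∀ c d u → smul (c *F d) u ≡ smul c (smul d u)
      smul-identity : ∀ u → smul 1# u ≡ u
      smul-zeroˡ    : ∀ u → smul 0# u ≡ zeroV
      complete      : ∀ v → v ∈ elems
      unique        : Unique elems

  module VectorSpace (X : FinSpace) (isVectorSpace : IsVectorSpace X) where
    open FinSpace X renaming (addV to infixl 6 _⊕_; smul to infixr 7 _·_)
    open IsVectorSpace isVectorSpace
    open Sp X

    infix 4 _⊑_
    _⊑_ : (S R : V → Bool) → Set
    S ⊑ R = ∀ v → T (S v) → T (R v)

    ⊑-trans : ∀ {S R Q} → S ⊑ R → R ⊑ Q → S ⊑ Q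
    ⊑-trans f g v = g v ∘ f v

    record IsSub (S : V → Bool) : Set where
      field
        has-0 : T (S zeroV)
        has-+ : ∀ {u v} → T (S u) → T (S v) → T (S (u ⊕ v))
        has-· : ∀ c {v} → T (S v) → T (S (c · v))
    open IsSub public

    T-⊆ᵇ : ∀ {S R} → T (S ⊆ᵇ R) ⇔ (S ⊑ R)
    T-⊆ᵇ {S} {R} = mk⇔
      (λ t v → to (T-⇒ {S v}) (to (T-allᵇ {xs = elems}) t (complete v)))
      (λ h → from (T-allᵇ {xs = elems}) (λ {v} _ → from (T-⇒ {S v}) (h v)))

    T-≐ᵇ : ∀ {S R} → T (S ≐ᵇ R) ⇔ (S ⊑ R × R ⊑ S)
    T-≐ᵇ {S} {R} = mk⇔
      (λ t → to (T-⊆ᵇ {S}) (proj₁ (to T-∧ t)) , to (T-⊆ᵇ {R}) (proj₂ (to T-∧ t)))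
      (λ (f , g) → from T-∧ (from (T-⊆ᵇ {S}) f , from (T-⊆ᵇ {R}) g))

    T-isSubspace : ∀ {S} → T (isSubspace S) ⇔ IsSub S
    T-isSubspace {S} = mk⇔
      (λ t → let (t0 , t′) = to (T-∧ {S zeroV}) t
                 (t+ , t·) = to T-∧ t′
             in record
               { has-0 = t0
               ; has-+ = λ {u} {v} Su Sv → to (T-⇒ {S u ∧ S v})
                   (to (T-allᵇ {xs = elems}) (to (T-allᵇ {xs = elems}) t+ (complete u)) (complete v)) (from T-∧ (Su , Sv))
               ; has-· = λ c {v} Sv → to (T-⇒ {S v})
                   (to (T-allᵇ {xs = elems}) (to (T-allᵇ {xs = elements}) t· (completeF c)) (complete v)) Sv
               })
      (λ h → from (T-∧ {S zeroV}) (has-0 h , from T-∧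
        ( from (T-allᵇ {xs = elems}) (λ {u} _ → from (T-allᵇ {xs = elems}) (λ {v} _ →
            from (T-⇒ {S u ∧ S v}) (λ t → has-+ h (proj₁ (to T-∧ t)) (proj₂ (to (T-∧ {S u}) t)))))
        , from (T-allᵇ {xs = elements}) (λ {c} _ → from (T-allᵇ {xs = elems}) (λ {v} _ →
            from (T-⇒ {S v}) (has-· h c))))))

    card-mono : ∀ {S R} → S ⊑ R → cardinality S ≤ cardinality R
    card-mono {S} {R} h = count-mono S R elems (λ {v} → h v)

    card-cong : ∀ {S R} → S ⊑ R → R ⊑ S → cardinality S ≡ cardinality R
    card-cong f g = ℕₚ.≤-antisym (card-mono f) (card-mono g)

    -- An element of `R` outside `S` would make the cardinality of `R` strictly larger.
    ⊑-card : ∀ {S R} → S ⊑ R → cardinality R ≤ cardinality S → R ⊑ S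
    ⊑-card {S} {R} h le v Rv = decidable-stable (T? (S v)) λ ¬Sv →
      ℕₚ.<⇒≱ (count-mono-< S R (λ {x} → h x) (complete v) ¬Sv Rv) le

    card-∑ : ∀ S → + cardinality S ≡ ∑ elems (𝟙 ∘ S)
    card-∑ S = length-filterᵇ S elems

    -- The case split behind the inductions over subspaces: either an inclusion holds, or a concrete
    -- vector witnesses its failure and can be adjoined.
    separate : ∀ S R → S ⊑ R ⊎ ∃ λ a → T (S a) × ¬ T (R a)
    separate S R with Any.any? (λ a → T? (S a) ×-dec ¬? (T? (R a))) elems
    ... | yes i = let (a , _ , h) = find i in inj₂ (a , h)
    ... | no ¬i = inj₁ (λ v Sv → decidable-stable (T? (R v)) (λ ¬Rv → ¬i (lose (complete v) (Sv , ¬Rv))))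

    shift-cancel : ∀ v {c d} a → c +F d ≡ 0# → (v ⊕ c · a) ⊕ d · a ≡ v
    shift-cancel v {c} {d} a e = begin
      (v ⊕ c · a) ⊕ d · a ≡⟨ add-assoc v (c · a) (d · a) ⟩
      v ⊕ (c · a ⊕ d · a) ≡⟨ cong (v ⊕_) (smul-distribʳ c d a) ⟨
      v ⊕ (c +F d) · a    ≡⟨ cong (λ z → v ⊕ z · a) e ⟩
      v ⊕ 0# · a          ≡⟨ cong (v ⊕_) (smul-zeroˡ a) ⟩
      v ⊕ zeroV           ≡⟨ add-identityʳ v ⟩
      v ∎
      where open ≡-Reasoning

    shift-zero : ∀ v a → v ⊕ 0# · a ≡ v
    shift-zero v a = trans (cong (v ⊕_) (smul-zeroˡ a)) (add-identityʳ v)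

    unscale : ∀ {S} → IsSub S → ∀ {c a} → c ≢ 0# → T (S (c · a)) → T (S a)
    unscale {S} sub {c} {a} c≢0 t = let (d , cd≡1) = inverse c c≢0 in
      subst (T ∘ S) (trans (sym (smul-assoc d c a)) (trans (cong (_· a) (trans (*F-comm d c) cd≡1)) (smul-identity a)))
        (has-· sub d t)

    -- Adjoining one vector to a subspace

    infixl 6 _⊞_
    -- For a subspace `S` this is S + <a>. Asking for a scalar with v + c·a in `S` reduces
    -- membership to a search over the field and presents the span as a union of translates of `S`.
    _⊞_ : (V → Bool) → V → (V → Bool)
    (S ⊞ a) v = ⌊ Any.any? (λ c → T? (S (v ⊕ c · a))) elements ⌋

    T-⊞ : ∀ {S a v} → T ((S ⊞ a) v) ⇔ (∃ λ c → T (S (v ⊕ c · a)))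
    T-⊞ {S} {a} {v} = mk⇔
      (λ t → let (c , _ , h) = find (toWitness {a? = Any.any? (λ c → T? (S (v ⊕ c · a))) elements} t) in c , h)
      (λ (c , h) → fromWitness {a? = Any.any? (λ c → T? (S (v ⊕ c · a))) elements} (lose (completeF c) h))

    ⊞-sub : ∀ {S} → IsSub S → ∀ a → IsSub (S ⊞ a)
    ⊞-sub {S} sub a .has-0 = from (T-⊞ {S}) (0# , subst (T ∘ S) (sym (shift-zero zeroV a)) (has-0 sub))
    ⊞-sub {S} sub a .has-+ {u} {v} tu tv = let (c , hu) = to (T-⊞ {S}) tu ; (d , hv) = to (T-⊞ {S}) tv in
      from (T-⊞ {S}) (c +F d , subst (T ∘ S) (regroup c d) (has-+ sub hu hv))
      where
      open ≡-Reasoning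
      regroup : ∀ c d → (u ⊕ c · a) ⊕ (v ⊕ d · a) ≡ (u ⊕ v) ⊕ (c +F d) · a
      regroup c d = begin
        (u ⊕ c · a) ⊕ (v ⊕ d · a) ≡⟨ add-assoc u _ _ ⟩
        u ⊕ (c · a ⊕ (v ⊕ d · a)) ≡⟨ cong (u ⊕_) (add-assoc _ v _) ⟨
        u ⊕ ((c · a ⊕ v) ⊕ d · a) ≡⟨ cong (λ z → u ⊕ (z ⊕ d · a)) (add-comm _ v) ⟩
        u ⊕ ((v ⊕ c · a) ⊕ d · a) ≡⟨ cong (u ⊕_) (add-assoc v _ _) ⟩
        u ⊕ (v ⊕ (c · a ⊕ d · a)) ≡⟨ add-assoc u v _ ⟨
        (u ⊕ v) ⊕ (c · a ⊕ d · a) ≡⟨ cong ((u ⊕ v) ⊕_) (smul-distribʳ c d a) ⟨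
        (u ⊕ v) ⊕ (c +F d) · a ∎
    ⊞-sub {S} sub a .has-· d {v} tv = let (c , hv) = to (T-⊞ {S}) tv in
      from (T-⊞ {S}) (d *F c , subst (T ∘ S)
        (trans (smul-distribˡ d v (c · a)) (cong (d · v ⊕_) (sym (smul-assoc d c a)))) (has-· sub d hv))

    ⊑⊞ : ∀ S a → S ⊑ S ⊞ a
    ⊑⊞ S a v Sv = from (T-⊞ {S}) (0# , subst (T ∘ S) (sym (shift-zero v a)) Sv)

    ∈⊞ : ∀ {S} → IsSub S → ∀ a → T ((S ⊞ a) a)
    ∈⊞ {S} sub a = from (T-⊞ {S}) (-F 1# , subst (T ∘ S)
      (sym (begin
        a ⊕ (-F 1#) · a      ≡⟨ cong (_⊕ (-F 1#) · a) (smul-identity a) ⟨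
        1# · a ⊕ (-F 1#) · a ≡⟨ smul-distribʳ 1# (-F 1#) a ⟨
        (1# +F -F 1#) · a    ≡⟨ cong (_· a) (-F-inverseʳ 1#) ⟩
        0# · a               ≡⟨ smul-zeroˡ a ⟩
        zeroV ∎))
      (has-0 sub))
      where open ≡-Reasoning

    ⊞-least : ∀ {S R a} → IsSub R → S ⊑ R → T (R a) → S ⊞ a ⊑ R
    ⊞-least {S} {R} {a} sub S⊑R Ra v t = let (c , h) = to (T-⊞ {S}) t in
      subst (T ∘ R) (shift-cancel v a (-F-inverseʳ c)) (has-+ sub (S⊑R _ h) (has-· sub (-F c) Ra))

    -- Translation by c·a is a permutation, inverted by translation by -c·a; the indicator of w = v
    -- + c·a transfers the sum from one variable to the other.
    ∑-shift : ∀ c a (f : V → ℤ) → ∑ elems (λ v → f (v ⊕ c · a)) ≡ ∑ elems f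
    ∑-shift c a f = begin
      ∑ elems (λ v → f (v ⊕ c · a))
        ≡⟨ ∑-cong elems (λ {v} _ → sym (∑-once elems (λ w → ⌊ eqV w (v ⊕ c · a) ⌋) f (∑-≟ eqV unique (complete _)) (λ _ t → cong f (toWitness t)))) ⟩
      ∑ elems (λ v → ∑ elems (λ w → 𝟙 ⌊ eqV w (v ⊕ c · a) ⌋ *ℤ f w))
        ≡⟨ ∑-swap elems elems (λ v w → 𝟙 ⌊ eqV w (v ⊕ c · a) ⌋ *ℤ f w) ⟩
      ∑ elems (λ w → ∑ elems (λ v → 𝟙 ⌊ eqV w (v ⊕ c · a) ⌋ *ℤ f w))
        ≡⟨ ∑-cong elems (λ {w} _ → ∑-*ʳ elems (λ v → 𝟙 ⌊ eqV w (v ⊕ c · a) ⌋) (f w)) ⟩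
      ∑ elems (λ w → ∑ elems (λ v → 𝟙 ⌊ eqV w (v ⊕ c · a) ⌋) *ℤ f w)
        ≡⟨ ∑-cong elems (λ {w} _ → cong (_*ℤ f w) (preimage w)) ⟩
      ∑ elems (λ w → 1ℤ *ℤ f w)
        ≡⟨ ∑-cong elems (λ {w} _ → ℤₚ.*-identityˡ (f w)) ⟩
      ∑ elems f ∎
      where
      open ≡-Reasoning
      preimage : ∀ w → ∑ elems (λ v → 𝟙 ⌊ eqV w (v ⊕ c · a) ⌋) ≡ 1ℤ
      preimage w = trans
        (∑-cong elems (λ {v} _ → 𝟙-cong {⌊ eqV w (v ⊕ c · a) ⌋} {⌊ eqV v (w ⊕ (-F c) · a) ⌋}
          (λ t → fromWitness (sym (trans (cong (_⊕ (-F c) · a) (toWitness t)) (shift-cancel v a (-F-inverseʳ c)))))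
          (λ t → fromWitness (sym (trans (cong (_⊕ c · a) (toWitness t)) (shift-cancel w a (-F-inverseˡ c)))))))
        (∑-≟ eqV unique (complete (w ⊕ (-F c) · a)))

    -- Count the pairs (v, c) with v + c·a in `S`. For fixed c there are |S|, by translation. For
    -- fixed v there is at most one, since two scalars c and d would put (c - d)·a, and then `a`,
    -- into `S`.
    card-⊞ : ∀ {S} → IsSub S → ∀ {a} → ¬ T (S a) → cardinality (S ⊞ a) ≡ q * cardinality S
    card-⊞ {S} sub {a} ¬Sa = ℤₚ.+-injective (begin
      + cardinality (S ⊞ a)
        ≡⟨ card-∑ (S ⊞ a) ⟩
      ∑ elems (𝟙 ∘ (S ⊞ a))
        ≡⟨ ∑-cong elems (λ {v} _ → sym (coefficient v)) ⟩
      ∑ elems (λ v → ∑ elements (λ c → 𝟙 (S (v ⊕ c · a))))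
        ≡⟨ ∑-swap elems elements (λ v c → 𝟙 (S (v ⊕ c · a))) ⟩
      ∑ elements (λ c → ∑ elems (λ v → 𝟙 (S (v ⊕ c · a))))
        ≡⟨ ∑-cong elements (λ {c} _ → trans (∑-shift c a (𝟙 ∘ S)) (sym (card-∑ S))) ⟩
      ∑ elements (const (+ cardinality S))
        ≡⟨ ∑-const elements (+ cardinality S) ⟩
      + length elements *ℤ + cardinality S
        ≡⟨ cong (λ z → + z *ℤ + cardinality S) card ⟩
      + q *ℤ + cardinality S
        ≡⟨ ℤₚ.pos-* q (cardinality S) ⟨
      + (q * cardinality S) ∎)
      where
      open ≡-Reasoning
      diff : ∀ v c d → (v ⊕ c · a) ⊕ (-F 1#) · (v ⊕ d · a) ≡ (c +F -F d) · a
      diff v c d = begin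
        (v ⊕ c · a) ⊕ (-F 1#) · (v ⊕ d · a)
          ≡⟨ cong ((v ⊕ c · a) ⊕_) (smul-distribˡ (-F 1#) v (d · a)) ⟩
        (v ⊕ c · a) ⊕ ((-F 1#) · v ⊕ (-F 1#) · d · a)
          ≡⟨ cong₂ (λ x y → x ⊕ ((-F 1#) · v ⊕ y)) (add-comm v (c · a)) neg ⟩
        (c · a ⊕ v) ⊕ ((-F 1#) · v ⊕ (-F d) · a)
          ≡⟨ add-assoc (c · a ⊕ v) _ _ ⟨
        ((c · a ⊕ v) ⊕ (-F 1#) · v) ⊕ (-F d) · a
          ≡⟨ cong (λ z → ((c · a ⊕ z) ⊕ (-F 1#) · v) ⊕ (-F d) · a) (smul-identity v) ⟨
        ((c · a ⊕ 1# · v) ⊕ (-F 1#) · v) ⊕ (-F d) · a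
          ≡⟨ cong (_⊕ (-F d) · a) (shift-cancel (c · a) v (-F-inverseʳ 1#)) ⟩
        c · a ⊕ (-F d) · a
          ≡⟨ smul-distribʳ c (-F d) a ⟨
        (c +F -F d) · a ∎
        where
        neg : (-F 1#) · d · a ≡ (-F d) · a
        neg = trans (sym (smul-assoc (-F 1#) d a)) (cong (_· a) (-1*x≈-x d))
      same : ∀ {v c d} → T (S (v ⊕ c · a)) → T (S (v ⊕ d · a)) → c ≡ d
      same {v} {c} {d} hc hd with c ≟F d
      ... | yes e = e
      ... | no c≢d = contradiction
        (unscale sub c-d≢0 (subst (T ∘ S) (diff v c d) (has-+ sub hc (has-· sub (-F 1#) hd)))) ¬Sa
        where
        c-d≢0 : c +F -F d ≢ 0#
        c-d≢0 e = c≢d (x∙y⁻¹≈ε⇒x≈y c d e)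
      coefficient : ∀ v → ∑ elements (λ c → 𝟙 (S (v ⊕ c · a))) ≡ 𝟙 ((S ⊞ a) v)
      coefficient v with T? ((S ⊞ a) v)
      ... | yes t = let (d , hd) = to (T-⊞ {S}) t in trans
        (∑-cong elements (λ {c} _ → 𝟙-cong {S (v ⊕ c · a)} {⌊ c ≟F d ⌋}
          (λ hc → fromWitness (same hc hd))
          (λ e → subst (λ z → T (S (v ⊕ z · a))) (sym (toWitness e)) hd)))
        (trans (∑-≟ _≟F_ uniqueF (completeF d)) (sym (𝟙-true t)))
      ... | no ¬t = trans (∑-false elements (λ c → S (v ⊕ c · a)) (λ {c} _ h → ¬t (from (T-⊞ {S}) (c , h))))
                      (sym (𝟙-false ¬t))

    -- Hyperplanes and dimension

    -- Codimension one is recorded as |W| = q|H|, because `dim` becomes an exact logarithm only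
    -- after cardinalities are shown to be powers of q, and that proof descends through hyperplanes.
    record Hyperplane (H W : V → Bool) : Set where
      field
        sub    : IsSub H
        below  : H ⊑ W
        point  : V
        inside : T (W point)
        off    : ¬ T (H point)
        card≡  : cardinality W ≡ q * cardinality H

    card-pos : ∀ {S} → IsSub S → 0 < cardinality S
    card-pos {S} sub = ℕₚ.≤-trans (s≤s z≤n)
      (count-mono-< (const false) S {y = zeroV} (λ ()) (complete zeroV) (λ ()) (has-0 sub))

    card-<-⊞ : ∀ {S} → IsSub S → ∀ {a} → ¬ T (S a) → cardinality S < cardinality (S ⊞ a)
    card-<-⊞ {S} sub {a} ¬Sa = count-mono-< S (S ⊞ a) (λ {x} → ⊑⊞ S a x) (complete a) ¬Sa (∈⊞ sub a)

    -- Vectors of `W` are adjoined to `U` until one more would exhaust `W`; the subspace reached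
    -- just before is the hyperplane. The fuel bounds |W| - |U|, which drops with every vector
    -- adjoined.
    hyperplane : ∀ {U W} → IsSub W → IsSub U → U ⊑ W → ∀ {a} → T (W a) → ¬ T (U a)
               → ∃ λ H → Hyperplane H W × U ⊑ H
    hyperplane {U} {W} subW subU U⊑W Wa ¬Ua = grow (cardinality W) subU U⊑W Wa ¬Ua (ℕₚ.m≤m+n _ _)
      where
      grow : ∀ fuel {U} → IsSub U → U ⊑ W → ∀ {a} → T (W a) → ¬ T (U a)
           → cardinality W ≤ fuel + cardinality U → ∃ λ H → Hyperplane H W × U ⊑ H
      grow zero    subU U⊑W Wa ¬Ua le = contradiction (⊑-card U⊑W le _ Wa) ¬Ua
      grow (suc f) {U} subU U⊑W {a} Wa ¬Ua le with separate W (U ⊞ a)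
      ... | inj₁ W⊑ = U , record
              { sub = subU ; below = U⊑W ; point = a ; inside = Wa ; off = ¬Ua
              ; card≡ = trans (card-cong W⊑ (⊞-least subW U⊑W Wa)) (card-⊞ subU ¬Ua) } , λ _ → λ t → t
      ... | inj₂ (b , Wb , ¬b) =
              let (H , hyp , h) = grow f (⊞-sub subU a) (⊞-least subW U⊑W Wa) Wb ¬b
                    (ℕₚ.≤-trans le (subst (_≤ f + cardinality (U ⊞ a)) (ℕₚ.+-suc f _) (ℕₚ.+-monoʳ-≤ f (card-<-⊞ subU ¬Ua))))
              in H , hyp , ⊑-trans {U} (⊑⊞ U a) h

    -- H + <b> lies in `W` and already has its cardinality q|H|.
    hyperplane-spans : ∀ {H W} → IsSub W → Hyperplane H W → ∀ {b} → T (W b) → ¬ T (H b) → W ⊑ H ⊞ b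
    hyperplane-spans {H} {W} subW hyp Wb ¬Hb = ⊑-card (⊞-least subW below Wb)
      (ℕₚ.≤-reflexive (trans card≡ (sym (card-⊞ sub ¬Hb))))
      where open Hyperplane hyp

    trivial : V → Bool
    trivial v = ⌊ eqV v zeroV ⌋

    smul-zeroʳ : ∀ c → c · zeroV ≡ zeroV
    smul-zeroʳ c = begin
      c · zeroV       ≡⟨ cong (c ·_) (smul-zeroˡ zeroV) ⟨
      c · 0# · zeroV  ≡⟨ smul-assoc c 0# zeroV ⟨
      (c *F 0#) · zeroV ≡⟨ cong (_· zeroV) (*F-zeroʳ c) ⟩
      0# · zeroV      ≡⟨ smul-zeroˡ zeroV ⟩
      zeroV ∎
      where open ≡-Reasoning

    trivial-sub : IsSub trivial
    trivial-sub .has-0 = fromWitness refl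
    trivial-sub .has-+ tu tv = fromWitness (trans (cong₂ _⊕_ (toWitness tu) (toWitness tv)) (add-identityʳ zeroV))
    trivial-sub .has-· c tv = fromWitness (trans (cong (c ·_) (toWitness tv)) (smul-zeroʳ c))

    trivial-⊑ : ∀ {S} → IsSub S → trivial ⊑ S
    trivial-⊑ {S} sub v t = subst (T ∘ S) (sym (toWitness t)) (has-0 sub)

    card-trivial : cardinality trivial ≡ 1
    card-trivial = ℤₚ.+-injective (trans (card-∑ trivial) (∑-≟ eqV unique (complete zeroV)))

    -- Each hyperplane divides the cardinality by q, and the descent ends at the zero subspace,
    -- which has one element.
    card-power : ∀ {W} → IsSub W → ∃ λ d → cardinality W ≡ q ^ d
    card-power {W} subW = go subW (<-wellFounded (cardinality W))
      where
      go : ∀ {W} → IsSub W → Acc _<_ (cardinality W) → ∃ λ d → cardinality W ≡ q ^ d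
      go {W} subW (acc rec) with separate W trivial
      ... | inj₁ W⊑ = 0 , trans (card-cong W⊑ (trivial-⊑ subW)) card-trivial
      ... | inj₂ (a , Wa , ¬a) =
        let (H , hyp , _) = hyperplane subW trivial-sub (trivial-⊑ subW) Wa ¬a
            open Hyperplane hyp
            (d , e) = go sub (rec (count-mono-< H W (λ {x} → below x) (complete point) off inside))
        in suc d , trans card≡ (cong (q *_) e)

    card-dim : ∀ {W} → IsSub W → cardinality W ≡ q ^ dim W
    card-dim {W} subW = let (d , e) = card-power subW in
      trans e (cong (q ^_) (sym (trans (cong (logq q) e) (logq-^ 1<q d))))

    dim-unique : ∀ {W} → IsSub W → ∀ d → cardinality W ≡ q ^ d → dim W ≡ d
    dim-unique subW d e = ^-injective 1<q _ d (trans (sym (card-dim subW)) e)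

    dim-cong : ∀ {S R} → S ⊑ R → R ⊑ S → dim S ≡ dim R
    dim-cong f g = cong (logq q) (card-cong f g)

    dim-mono : ∀ {S R} → IsSub S → IsSub R → S ⊑ R → dim S ≤ dim R
    dim-mono {S} {R} subS subR h = ℕₚ.≮⇒≥ λ lt →
      ℕₚ.<⇒≱ (ℕₚ.^-monoʳ-< q 1<q lt) (subst₂ _≤_ (card-dim subS) (card-dim subR) (card-mono h))

    dim-trivial : dim trivial ≡ 0
    dim-trivial = dim-unique trivial-sub 0 card-trivial

    dim-hyperplane : ∀ {H W} → IsSub W → Hyperplane H W → dim W ≡ suc (dim H)
    dim-hyperplane subW hyp = dim-unique subW _ (trans card≡ (cong (q *_) (card-dim sub)))
      where open Hyperplane hyp

    ∈-subspaces : ∀ {J} → J ∈ subspaces → IsSub J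
    ∈-subspaces i = to T-isSubspace (proj₂ (∈-filter⁻ (λ S → T? (isSubspace S)) {xs = preds eqV elems} i))

    -- The test `isSubspace` is absorbed: a predicate that agrees with `S` everywhere is a subspace
    -- because `S` is. What remains is that exactly one listed predicate agrees with `S`.
    subspaces-once : ∀ {S} → IsSub S → ∑ subspaces (λ J → 𝟙 (J ≐ᵇ S)) ≡ 1ℤ
    subspaces-once {S} sub = begin
      ∑ subspaces (λ J → 𝟙 (J ≐ᵇ S))
        ≡⟨ ∑-filterᵇ isSubspace (preds eqV elems) (λ J → 𝟙 (J ≐ᵇ S)) ⟩
      ∑ (preds eqV elems) (λ J → 𝟙 (isSubspace J) *ℤ 𝟙 (J ≐ᵇ S))
        ≡⟨ ∑-cong (preds eqV elems) (λ {J} _ → trans (sym (𝟙-∧ (isSubspace J) (J ≐ᵇ S))) (𝟙-cong (⇒agree J) (agree⇒ J))) ⟩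
      ∑ (preds eqV elems) (λ J → 𝟙 (agree eqV S J elems))
        ≡⟨ preds-once eqV unique S ⟩
      1ℤ ∎
      where
      open ≡-Reasoning
      ⇒agree : ∀ J → T (isSubspace J ∧ (J ≐ᵇ S)) → T (agree eqV S J elems)
      ⇒agree J t = let (f , g) = to (T-≐ᵇ {J}) (proj₂ (to (T-∧ {isSubspace J}) t)) in
        from (T-allᵇ {xs = elems}) (λ {v} _ → fromWitness (Bool-ext (f v) (g v)))
        where
        Bool-ext : ∀ {a b} → (T a → T b) → (T b → T a) → a ≡ b
        Bool-ext {false} {false} _ _ = refl
        Bool-ext {false} {true}  _ g = ⊥-elim (g tt)
        Bool-ext {true}  {false} f _ = ⊥-elim (f tt)
        Bool-ext {true}  {true}  _ _ = refl
      agree⇒ : ∀ J → T (agree eqV S J elems) → T (isSubspace J ∧ (J ≐ᵇ S))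
      agree⇒ J t = from T-∧ (from T-isSubspace subJ , from (T-≐ᵇ {J})
        ((λ v → subst T (J≡S v)) , (λ v → subst T (sym (J≡S v)))))
        where
        J≡S : ∀ v → J v ≡ S v
        J≡S v = toWitness (to (T-allᵇ {xs = elems}) t (complete v))
        subJ : IsSub J
        subJ .has-0 = subst T (sym (J≡S _)) (has-0 sub)
        subJ .has-+ Ju Jv = subst T (sym (J≡S _)) (has-+ sub (subst T (J≡S _) Ju) (subst T (J≡S _) Jv))
        subJ .has-· c Jv = subst T (sym (J≡S _)) (has-· sub c (subst T (J≡S _) Jv))

    infixr 7 _⊓_
    _⊓_ : (S R : V → Bool) → (V → Bool)
    (S ⊓ R) v = S v ∧ R v

    ⊓-sub : ∀ {S R} → IsSub S → IsSub R → IsSub (S ⊓ R)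
    ⊓-sub subS subR .has-0 = from T-∧ (has-0 subS , has-0 subR)
    ⊓-sub {S} subS subR .has-+ {u} {v} tu tv = let (Su , Ru) = to (T-∧ {S u}) tu ; (Sv , Rv) = to (T-∧ {S v}) tv in
      from T-∧ (has-+ subS Su Sv , has-+ subR Ru Rv)
    ⊓-sub {S} subS subR .has-· c {v} tv = let (Sv , Rv) = to (T-∧ {S v}) tv in
      from T-∧ (has-· subS c Sv , has-· subR c Rv)

    -- Lifting subspaces of a hyperplane

    count-diff : ∀ J H → ∑ elems (λ b → 𝟙 (J b ∧ not (H b))) ≡ + cardinality J -ℤ + cardinality (J ⊓ H)
    count-diff J H = begin
      ∑ elems (λ b → 𝟙 (J b ∧ not (H b)))
        ≡⟨ ∑-cong elems (λ {b} _ → 𝟙-diff (J b) (H b)) ⟩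
      ∑ elems (λ b → 𝟙 (J b) -ℤ 𝟙 ((J ⊓ H) b))
        ≡⟨ ∑-diff elems (𝟙 ∘ J) (𝟙 ∘ (J ⊓ H)) ⟩
      ∑ elems (𝟙 ∘ J) -ℤ ∑ elems (𝟙 ∘ (J ⊓ H))
        ≡⟨ cong₂ _-ℤ_ (card-∑ J) (card-∑ (J ⊓ H)) ⟨
      + cardinality J -ℤ + cardinality (J ⊓ H) ∎
      where open ≡-Reasoning

    q-1 : ℤ
    q-1 = + q -ℤ 1ℤ

    q-1≡ : q-1 ≡ + (q ∸ 1)
    q-1≡ = sym (+[m∸n] (ℕₚ.<⇒≤ 1<q))

    excess : ∀ {a b} → a ≡ q * b → + a -ℤ + b ≡ q-1 *ℤ + b
    excess {a} {b} e = trans (cong (λ z → z -ℤ + b) (trans (cong +_ e) (ℤₚ.pos-* q b))) (factor (+ q) (+ b))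
      where
      factor : ∀ x y → x *ℤ y -ℤ y ≡ (x -ℤ 1ℤ) *ℤ y
      factor = solve-∀

    -- (q - 1)q^k is the number of points that a lift has outside the hyperplane, k being the
    -- dimension of the lifted subspace; it is divided out of the double count.
    q-1-cancel : ∀ N k d → N *ℤ (q-1 *ℤ + (q ^ k)) ≡ q-1 *ℤ + (q ^ (d + k)) → N ≡ + (q ^ d)
    q-1-cancel N k d e = ℤₚ.*-cancelʳ-≡ N (+ (q ^ d)) (+ ((q ∸ 1) * q ^ k)) {{nonZero}} (begin
      N *ℤ + ((q ∸ 1) * q ^ k)         ≡⟨ cong (N *ℤ_) (scale k) ⟨
      N *ℤ (q-1 *ℤ + (q ^ k))          ≡⟨ e ⟩
      q-1 *ℤ + (q ^ (d + k))           ≡⟨ cong (q-1 *ℤ_) (trans (cong +_ (ℕₚ.^-distribˡ-+-* q d k)) (ℤₚ.pos-* (q ^ d) (q ^ k))) ⟩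
      q-1 *ℤ (+ (q ^ d) *ℤ + (q ^ k))  ≡⟨ swap q-1 (+ (q ^ d)) (+ (q ^ k)) ⟩
      + (q ^ d) *ℤ (q-1 *ℤ + (q ^ k))  ≡⟨ cong (+ (q ^ d) *ℤ_) (scale k) ⟩
      + (q ^ d) *ℤ + ((q ∸ 1) * q ^ k) ∎)
      where
      open ≡-Reasoning
      scale : ∀ k → q-1 *ℤ + (q ^ k) ≡ + ((q ∸ 1) * q ^ k)
      scale k = trans (cong (_*ℤ + (q ^ k)) q-1≡) (sym (ℤₚ.pos-* (q ∸ 1) (q ^ k)))
      swap : ∀ x y z → x *ℤ (y *ℤ z) ≡ y *ℤ (x *ℤ z)
      swap = solve-∀
      nonZero : Data.Integer.NonZero (+ ((q ∸ 1) * q ^ k))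
      nonZero = ℕₚ.m*n≢0 (q ∸ 1) (q ^ k) {{>-nonZero (ℕₚ.m<n⇒0<n∸m 1<q)}} {{ℕₚ.m^n≢0 q k}}

    module _ {H W : V → Bool} (subW : IsSub W) (hyp : Hyperplane H W) where
      open Hyperplane hyp

      -- As W = H + <b>, every v in `J` has some v + c·b in `H`; since b is in `J`, so is the
      -- shifted vector, and it falls into J ∩ H.
      spanned : ∀ {J K b} → IsSub J → J ⊑ W → K ⊑ J ⊓ H → J ⊓ H ⊑ K → T (J b) → ¬ T (H b)
              → J ⊑ K ⊞ b × K ⊞ b ⊑ J
      spanned {J} {K} {b} subJ J⊑W K⊑ ⊑K Jb ¬Hb =
        (λ v Jv → let (c , h) = to (T-⊞ {H}) (hyperplane-spans subW hyp (J⊑W b Jb) ¬Hb v (J⊑W v Jv)) in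
          from (T-⊞ {K}) (c , ⊑K _ (from T-∧ (has-+ subJ Jv (has-· subJ c Jb) , h)))) ,
        ⊞-least subJ (λ v Kv → proj₁ (to (T-∧ {J v}) (K⊑ v Kv))) Jb

      card-lift : ∀ {J K} → IsSub J → IsSub K → J ⊑ W → ∀ {b} → T (J b) → ¬ T (H b) → K ⊑ J ⊓ H → J ⊓ H ⊑ K
                → cardinality J ≡ q * cardinality K
      card-lift {J} {K} subJ subK J⊑W {b} Jb ¬Hb K⊑ ⊑K =
        let (f , g) = spanned {J} {K} subJ J⊑W K⊑ ⊑K Jb ¬Hb in
        trans (card-cong f g) (card-⊞ subK (λ Kb → ¬Hb (proj₂ (to (T-∧ {J b}) (K⊑ b Kb)))))

      lifts : (K J : V → Bool) → Bool
      lifts K J = ((J ⊆ᵇ W) ∧ not (J ⊆ᵇ H)) ∧ (K ≐ᵇ (J ⊓ H))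

      -- The decided condition `lifts` with a point of `J` outside `H` made explicit; that point
      -- spans `J` over `K`.
      record Lifts (K J : V → Bool) : Set where
        field
          in-W  : J ⊑ W
          apex  : V
          apex∈ : T (J apex)
          apex∉ : ¬ T (H apex)
          ⊑meet : K ⊑ J ⊓ H
          meet⊑ : J ⊓ H ⊑ K

      T-lifts : ∀ K J → T (lifts K J) ⇔ Lifts K J
      T-lifts K J = mk⇔
        (λ t → let (t1 , t2) = to (T-∧ {(J ⊆ᵇ W) ∧ not (J ⊆ᵇ H)}) t
                   (t3 , t4) = to (T-∧ {J ⊆ᵇ W}) t1
                   (f , g) = to (T-≐ᵇ {K}) t2
               in fwd (to T-⊆ᵇ t3) (to T-not t4) f g)
        (λ l → let open Lifts l in from T-∧
          ( from T-∧ (from T-⊆ᵇ in-W , from T-not (λ t → apex∉ (to (T-⊆ᵇ {J}) t apex apex∈)))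
          , from T-≐ᵇ (⊑meet , meet⊑)))
        where
        fwd : J ⊑ W → ¬ T (J ⊆ᵇ H) → K ⊑ J ⊓ H → J ⊓ H ⊑ K → Lifts K J
        fwd J⊑W ¬J⊆H f g with separate J H
        ... | inj₁ J⊑H = contradiction (from T-⊆ᵇ J⊑H) ¬J⊆H
        ... | inj₂ (a , Ja , ¬Ha) = record { in-W = J⊑W ; apex = a ; apex∈ = Ja ; apex∉ = ¬Ha ; ⊑meet = f ; meet⊑ = g }

      lifts-⊞ : ∀ {K b} → IsSub K → K ⊑ H → T (W b) → ¬ T (H b) → ∀ {J} → J ⊑ K ⊞ b → K ⊞ b ⊑ J → Lifts K J × T (J b)
      lifts-⊞ {K} {b} subK K⊑H Wb ¬Hb {J} f g = record
        { in-W = ⊑-trans {J} f (⊞-least subW (⊑-trans {K} K⊑H below) Wb) ; apex = b ; apex∈ = Jb ; apex∉ = ¬Hb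
        ; ⊑meet = λ v Kv → from T-∧ (g v (⊑⊞ K b v Kv) , K⊑H v Kv)
        ; meet⊑ = meet⊑ } , Jb
        where
        Jb : T (J b)
        Jb = g b (∈⊞ subK b)
        meet⊑ : J ⊓ H ⊑ K
        meet⊑ v t with to (T-∧ {J v}) t
        ... | Jv , Hv with to (T-⊞ {K}) (f v Jv)
        ... | c , h with c ≟F 0#
        ... | yes refl = subst (T ∘ K) (shift-zero v b) h
        -- `v` and v + c·b both lie in `H`, hence so does c·b, and for c ≠ 0 also `b`.
        ... | no c≢0 = contradiction (unscale sub c≢0 (subst (T ∘ H) cb≡ (has-+ sub (has-· sub (-F 1#) Hv) (K⊑H _ h)))) ¬Hb
          where
          open ≡-Reasoning
          cb≡ : (-F 1#) · v ⊕ (v ⊕ c · b) ≡ c · b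
          cb≡ = begin
            (-F 1#) · v ⊕ (v ⊕ c · b)      ≡⟨ add-comm _ _ ⟩
            (v ⊕ c · b) ⊕ (-F 1#) · v      ≡⟨ cong (_⊕ (-F 1#) · v) (add-comm v (c · b)) ⟩
            (c · b ⊕ v) ⊕ (-F 1#) · v      ≡⟨ cong (λ z → (c · b ⊕ z) ⊕ (-F 1#) · v) (smul-identity v) ⟨
            (c · b ⊕ 1# · v) ⊕ (-F 1#) · v ≡⟨ shift-cancel (c · b) v (-F-inverseʳ 1#) ⟩
            c · b ∎

      -- Double count the pairs (J, b) with b ∈ J ∖ H: each b ∈ W ∖ H lies in the single J = K + ⟨b⟩.
      count-lifts : ∀ {K} → IsSub K → K ⊑ H → ∑ subspaces (λ J → 𝟙 (lifts K J)) ≡ + (q ^ (dim H ∸ dim K))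
      count-lifts {K} subK K⊑H = q-1-cancel (∑ subspaces (𝟙 ∘ lifts K)) (dim K) (dim H ∸ dim K) (begin
        ∑ subspaces (𝟙 ∘ lifts K) *ℤ (q-1 *ℤ + (q ^ dim K))
          ≡⟨ ∑-*ʳ subspaces (𝟙 ∘ lifts K) (q-1 *ℤ + (q ^ dim K)) ⟨
        ∑ subspaces (λ J → 𝟙 (lifts K J) *ℤ (q-1 *ℤ + (q ^ dim K)))
          ≡⟨ ∑-cong subspaces (λ {J} i → 𝟙-guard (lifts K J) (q-1 *ℤ + (q ^ dim K)) (∑ elems (λ b → 𝟙 (J b ∧ not (H b)))) (λ t → sym (apexes i (to (T-lifts K J) t)))) ⟩
        ∑ subspaces (λ J → 𝟙 (lifts K J) *ℤ ∑ elems (λ b → 𝟙 (J b ∧ not (H b))))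
          ≡⟨ ∑-cong subspaces (λ {J} _ → sym (∑-*ˡ elems (𝟙 (lifts K J)) (λ b → 𝟙 (J b ∧ not (H b))))) ⟩
        ∑ subspaces (λ J → ∑ elems (λ b → 𝟙 (lifts K J) *ℤ 𝟙 (J b ∧ not (H b))))
          ≡⟨ ∑-swap subspaces elems (λ J b → 𝟙 (lifts K J) *ℤ 𝟙 (J b ∧ not (H b))) ⟩
        ∑ elems (λ b → ∑ subspaces (λ J → 𝟙 (lifts K J) *ℤ 𝟙 (J b ∧ not (H b))))
          ≡⟨ ∑-cong elems (λ {b} _ → through b) ⟩
        ∑ elems (λ b → 𝟙 (W b ∧ not (H b)))
          ≡⟨ count-diff W H ⟩
        + cardinality W -ℤ + cardinality (W ⊓ H)
          ≡⟨ cong (λ z → + cardinality W -ℤ + z) (card-cong {W ⊓ H} (λ v t → proj₂ (to (T-∧ {W v}) t)) (λ v Hv → from T-∧ (below v Hv , Hv))) ⟩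
        + cardinality W -ℤ + cardinality H
          ≡⟨ excess card≡ ⟩
        q-1 *ℤ + cardinality H
          ≡⟨ cong (λ z → q-1 *ℤ + z) (card-dim sub) ⟩
        q-1 *ℤ + (q ^ dim H)
          ≡⟨ cong (λ z → q-1 *ℤ + (q ^ z)) (ℕₚ.m∸n+n≡m (dim-mono subK sub K⊑H)) ⟨
        q-1 *ℤ + (q ^ (dim H ∸ dim K + dim K)) ∎)
        where
        open ≡-Reasoning
        apexes : ∀ {J} → J ∈ subspaces → Lifts K J → ∑ elems (λ b → 𝟙 (J b ∧ not (H b))) ≡ q-1 *ℤ + (q ^ dim K)
        apexes {J} i l = begin
          ∑ elems (λ b → 𝟙 (J b ∧ not (H b)))       ≡⟨ count-diff J H ⟩
          + cardinality J -ℤ + cardinality (J ⊓ H)  ≡⟨ cong (λ z → + cardinality J -ℤ + z) (card-cong meet⊑ ⊑meet) ⟩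
          + cardinality J -ℤ + cardinality K        ≡⟨ excess (card-lift (∈-subspaces i) subK in-W apex∈ apex∉ ⊑meet meet⊑) ⟩
          q-1 *ℤ + cardinality K                    ≡⟨ cong (λ z → q-1 *ℤ + z) (card-dim subK) ⟩
          q-1 *ℤ + (q ^ dim K) ∎
          where open Lifts l
        combine : ∀ b J → 𝟙 (lifts K J) *ℤ 𝟙 (J b ∧ not (H b)) ≡ 𝟙 (lifts K J ∧ (J b ∧ not (H b)))
        combine b J = sym (𝟙-∧ (lifts K J) (J b ∧ not (H b)))
        through : ∀ b → ∑ subspaces (λ J → 𝟙 (lifts K J) *ℤ 𝟙 (J b ∧ not (H b))) ≡ 𝟙 (W b ∧ not (H b))
        through b with T? (W b ∧ not (H b))
        ... | yes t = let (Wb , nHb) = to (T-∧ {W b}) t ; ¬Hb = to T-not nHb in trans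
          (∑-cong subspaces (λ {J} i → trans (combine b J) (𝟙-cong {lifts K J ∧ (J b ∧ not (H b))} {J ≐ᵇ (K ⊞ b)}
            (λ s → let (s1 , s2) = to (T-∧ {lifts K J}) s ; l = to (T-lifts K J) s1 in
               from T-≐ᵇ (spanned {J} {K} (∈-subspaces i) (Lifts.in-W l) (Lifts.⊑meet l) (Lifts.meet⊑ l) (proj₁ (to (T-∧ {J b}) s2)) ¬Hb))
            (λ s → let (f , g) = to (T-≐ᵇ {J}) s ; (l , Jb) = lifts-⊞ subK K⊑H Wb ¬Hb f g in
               from T-∧ (from (T-lifts K J) l , from T-∧ (Jb , nHb))))))
          (trans (subspaces-once (⊞-sub subK b)) (sym (𝟙-true t)))
        ... | no ¬t = trans
          (trans (∑-cong subspaces (λ {J} _ → combine b J))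
            (∑-false subspaces (λ J → lifts K J ∧ (J b ∧ not (H b))) (λ {J} _ s →
              let (s1 , s2) = to (T-∧ {lifts K J}) s ; (Jb , nHb) = to (T-∧ {J b}) s2 in
              ¬t (from T-∧ (Lifts.in-W (to (T-lifts K J) s1) b Jb , nHb)))))
          (sym (𝟙-false ¬t))

      -- The weight depends on `J` through its dimension only, and as U ≤ H the condition U ≤ J
      -- depends on J ∩ H only. Both are thus constant on the lifts of K, whose number is known. `g`
      -- stays arbitrary so that the step serves the Möbius sum and the dimension counts alike.
      ∑-hyperplane : ∀ {U} → U ⊑ H → (g : ℕ → ℤ)
        → ∑ (subspacesOf W) (λ J → 𝟙 (U ⊆ᵇ J) *ℤ g (dim J))
        ≡ ∑ (subspacesOf H) (λ K → 𝟙 (U ⊆ᵇ K) *ℤ (g (dim K) +ℤ + (q ^ (dim H ∸ dim K)) *ℤ g (suc (dim K))))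
      ∑-hyperplane {U} U⊑H g = begin
        ∑ (subspacesOf W) term
          ≡⟨ ∑-filterᵇ (_⊆ᵇ W) subspaces term ⟩
        ∑ subspaces (λ J → 𝟙 (J ⊆ᵇ W) *ℤ term J)
          ≡⟨ ∑-cong subspaces (λ {J} _ → trans (cong (_*ℤ term J) (cases J)) (ℤₚ.*-distribʳ-+ (term J) (𝟙 (J ⊆ᵇ H)) (𝟙 (across J)))) ⟩
        ∑ subspaces (λ J → 𝟙 (J ⊆ᵇ H) *ℤ term J +ℤ 𝟙 (across J) *ℤ term J)
          ≡⟨ ∑-+ subspaces (λ J → 𝟙 (J ⊆ᵇ H) *ℤ term J) (λ J → 𝟙 (across J) *ℤ term J) ⟩
        ∑ subspaces (λ J → 𝟙 (J ⊆ᵇ H) *ℤ term J) +ℤ ∑ subspaces (λ J → 𝟙 (across J) *ℤ term J)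
          ≡⟨ cong (∑ subspaces (λ J → 𝟙 (J ⊆ᵇ H) *ℤ term J) +ℤ_) acrossSum ⟩
        ∑ subspaces (λ J → 𝟙 (J ⊆ᵇ H) *ℤ term J) +ℤ ∑ subspaces (λ K → 𝟙 (K ⊆ᵇ H) *ℤ (+ (q ^ (dim H ∸ dim K)) *ℤ up K))
          ≡⟨ ∑-+ subspaces (λ J → 𝟙 (J ⊆ᵇ H) *ℤ term J) (λ K → 𝟙 (K ⊆ᵇ H) *ℤ (+ (q ^ (dim H ∸ dim K)) *ℤ up K)) ⟨
        ∑ subspaces (λ K → 𝟙 (K ⊆ᵇ H) *ℤ term K +ℤ 𝟙 (K ⊆ᵇ H) *ℤ (+ (q ^ (dim H ∸ dim K)) *ℤ up K))
          ≡⟨ ∑-cong subspaces (λ {K} _ → collect (𝟙 (K ⊆ᵇ H)) (𝟙 (U ⊆ᵇ K)) (g (dim K)) (+ (q ^ (dim H ∸ dim K))) (g (suc (dim K)))) ⟩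
        ∑ subspaces (λ K → 𝟙 (K ⊆ᵇ H) *ℤ (𝟙 (U ⊆ᵇ K) *ℤ (g (dim K) +ℤ + (q ^ (dim H ∸ dim K)) *ℤ g (suc (dim K)))))
          ≡⟨ ∑-filterᵇ (_⊆ᵇ H) subspaces (λ K → 𝟙 (U ⊆ᵇ K) *ℤ (g (dim K) +ℤ + (q ^ (dim H ∸ dim K)) *ℤ g (suc (dim K)))) ⟨
        ∑ (subspacesOf H) (λ K → 𝟙 (U ⊆ᵇ K) *ℤ (g (dim K) +ℤ + (q ^ (dim H ∸ dim K)) *ℤ g (suc (dim K)))) ∎
        where
        open ≡-Reasoning
        term up : (V → Bool) → ℤ
        term J = 𝟙 (U ⊆ᵇ J) *ℤ g (dim J)
        up K = 𝟙 (U ⊆ᵇ K) *ℤ g (suc (dim K))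
        across : (V → Bool) → Bool
        across J = (J ⊆ᵇ W) ∧ not (J ⊆ᵇ H)
        collect : ∀ a b x y z → a *ℤ (b *ℤ x) +ℤ a *ℤ (y *ℤ (b *ℤ z)) ≡ a *ℤ (b *ℤ (x +ℤ y *ℤ z))
        collect = solve-∀
        cases : ∀ J → 𝟙 (J ⊆ᵇ W) ≡ 𝟙 (J ⊆ᵇ H) +ℤ 𝟙 (across J)
        cases J with J ⊆ᵇ W in w | J ⊆ᵇ H in h
        ... | true  | true  = refl
        ... | true  | false = refl
        ... | false | false = refl
        ... | false | true  = contradiction (from T-⊆ᵇ (⊑-trans {J} (to (T-⊆ᵇ {J}) (from T-≡ h)) below)) (subst (λ z → ¬ T z) (sym w) (λ ()))
        acrossSum : ∑ subspaces (λ J → 𝟙 (across J) *ℤ term J)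
                  ≡ ∑ subspaces (λ K → 𝟙 (K ⊆ᵇ H) *ℤ (+ (q ^ (dim H ∸ dim K)) *ℤ up K))
        acrossSum = begin
          ∑ subspaces (λ J → 𝟙 (across J) *ℤ term J)
            -- The sum over K with K = J ∩ H has a single term; inserting it lets the whole sum be
            -- reorganised by K.
            ≡⟨ ∑-cong subspaces (λ {J} i → 𝟙-guard (across J) (term J) _ (λ t → sym
                 (∑-once subspaces (λ K → K ≐ᵇ (J ⊓ H)) (λ K → 𝟙 (K ⊆ᵇ H) *ℤ up K) (subspaces-once (⊓-sub (∈-subspaces i) sub)) (λ k s → at-meet i k t s)))) ⟩
          ∑ subspaces (λ J → 𝟙 (across J) *ℤ ∑ subspaces (λ K → 𝟙 (K ≐ᵇ (J ⊓ H)) *ℤ (𝟙 (K ⊆ᵇ H) *ℤ up K)))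
            ≡⟨ ∑-cong subspaces (λ {J} _ → trans (sym (∑-*ˡ subspaces (𝟙 (across J)) (λ K → 𝟙 (K ≐ᵇ (J ⊓ H)) *ℤ (𝟙 (K ⊆ᵇ H) *ℤ up K))))
                 (∑-cong subspaces (λ {K} _ → regroup (across J) (K ≐ᵇ (J ⊓ H)) (𝟙 (K ⊆ᵇ H) *ℤ up K)))) ⟩
          ∑ subspaces (λ J → ∑ subspaces (λ K → 𝟙 (lifts K J) *ℤ (𝟙 (K ⊆ᵇ H) *ℤ up K)))
            ≡⟨ ∑-swap subspaces subspaces (λ J K → 𝟙 (lifts K J) *ℤ (𝟙 (K ⊆ᵇ H) *ℤ up K)) ⟩
          ∑ subspaces (λ K → ∑ subspaces (λ J → 𝟙 (lifts K J) *ℤ (𝟙 (K ⊆ᵇ H) *ℤ up K)))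
            ≡⟨ ∑-cong subspaces (λ {K} _ → trans (∑-*ʳ subspaces (𝟙 ∘ lifts K) (𝟙 (K ⊆ᵇ H) *ℤ up K)) (rotate (∑ subspaces (𝟙 ∘ lifts K)) (𝟙 (K ⊆ᵇ H)) (up K))) ⟩
          ∑ subspaces (λ K → 𝟙 (K ⊆ᵇ H) *ℤ (∑ subspaces (𝟙 ∘ lifts K) *ℤ up K))
            ≡⟨ ∑-cong subspaces (λ {K} k → 𝟙-guard (K ⊆ᵇ H) (∑ subspaces (𝟙 ∘ lifts K) *ℤ up K) (+ (q ^ (dim H ∸ dim K)) *ℤ up K)
                 (λ t → cong (_*ℤ up K) (count-lifts (∈-subspaces k) (to T-⊆ᵇ t)))) ⟩
          ∑ subspaces (λ K → 𝟙 (K ⊆ᵇ H) *ℤ (+ (q ^ (dim H ∸ dim K)) *ℤ up K)) ∎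
          where
          rotate : ∀ x y z → x *ℤ (y *ℤ z) ≡ y *ℤ (x *ℤ z)
          rotate = solve-∀
          regroup : ∀ a b x → 𝟙 a *ℤ (𝟙 b *ℤ x) ≡ 𝟙 (a ∧ b) *ℤ x
          regroup a b x = trans (sym (ℤₚ.*-assoc (𝟙 a) (𝟙 b) x)) (cong (_*ℤ x) (sym (𝟙-∧ a b)))
          at-meet : ∀ {J K} → J ∈ subspaces → K ∈ subspaces → T (across J) → T (K ≐ᵇ (J ⊓ H)) → 𝟙 (K ⊆ᵇ H) *ℤ up K ≡ term J
          at-meet {J} {K} i k t s = begin
            𝟙 (K ⊆ᵇ H) *ℤ up K ≡⟨ cong (_*ℤ up K) (𝟙-true (from T-⊆ᵇ (λ v Kv → proj₂ (to (T-∧ {J v}) (⊑meet v Kv))))) ⟩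
            1ℤ *ℤ up K         ≡⟨ ℤₚ.*-identityˡ (up K) ⟩
            𝟙 (U ⊆ᵇ K) *ℤ g (suc (dim K)) ≡⟨ cong₂ (λ x y → x *ℤ g y)
              (𝟙-cong {U ⊆ᵇ K} {U ⊆ᵇ J}
                (λ u → from T-⊆ᵇ (λ v Uv → proj₁ (to (T-∧ {J v}) (⊑meet v (to (T-⊆ᵇ {U}) u v Uv)))))
                (λ u → from T-⊆ᵇ (λ v Uv → meet⊑ v (from T-∧ (to (T-⊆ᵇ {U}) u v Uv , U⊑H v Uv)))))
              (sym (dim-unique (∈-subspaces i) _ (trans (card-lift (∈-subspaces i) (∈-subspaces k) in-W apex∈ apex∉ ⊑meet meet⊑) (cong (q *_) (card-dim (∈-subspaces k)))))) ⟩
            term J ∎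
            where
            open Lifts (to (T-lifts K J) (from T-∧ (t , s)))

    -- Möbius sums over intervals of subspaces

    ∈-subspacesOf : ∀ {W J} → J ∈ subspacesOf W → IsSub J × J ⊑ W
    ∈-subspacesOf {W} i = let (j , t) = ∈-filter⁻ (λ S → T? (S ⊆ᵇ W)) {xs = subspaces} i in ∈-subspaces j , to T-⊆ᵇ t

    -- For U = W only J = W remains, with weight 1. Otherwise one step over a hyperplane that
    -- contains `U` suffices, without induction: the constraint U ≤ J survives on the hyperplane,
    -- and the term of each K there is already 0.
    ∑-möbius : ∀ {U W} → IsSub U → IsSub W → U ⊑ W
             → ∑ (subspacesOf W) (λ J → 𝟙 (U ⊆ᵇ J) *ℤ möbius q (dim W ∸ dim J)) ≡ 𝟙 (W ⊆ᵇ U)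
    ∑-möbius {U} {W} subU subW U⊑W with separate W U
    ... | inj₁ W⊑U = begin
      ∑ (subspacesOf W) term
        ≡⟨ ∑-filterᵇ (_⊆ᵇ W) subspaces term ⟩
      ∑ subspaces (λ J → 𝟙 (J ⊆ᵇ W) *ℤ term J)
        ≡⟨ ∑-cong subspaces (λ {J} _ → trans (sym (ℤₚ.*-assoc (𝟙 (J ⊆ᵇ W)) (𝟙 (U ⊆ᵇ J)) _)) (cong (_*ℤ möbius q (dim W ∸ dim J)) (both J))) ⟩
      ∑ subspaces (λ J → 𝟙 (J ≐ᵇ W) *ℤ möbius q (dim W ∸ dim J))
        ≡⟨ ∑-once subspaces (λ J → J ≐ᵇ W) (λ J → möbius q (dim W ∸ dim J)) (subspaces-once subW)
             (λ {J} _ t → let (f , g) = to (T-≐ᵇ {J}) t in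
               cong (möbius q) (trans (cong (dim W ∸_) (dim-cong f g)) (ℕₚ.n∸n≡0 (dim W)))) ⟩
      1ℤ
        ≡⟨ 𝟙-true (from T-⊆ᵇ W⊑U) ⟨
      𝟙 (W ⊆ᵇ U) ∎
      where
      open ≡-Reasoning
      term : (V → Bool) → ℤ
      term J = 𝟙 (U ⊆ᵇ J) *ℤ möbius q (dim W ∸ dim J)
      both : ∀ J → 𝟙 (J ⊆ᵇ W) *ℤ 𝟙 (U ⊆ᵇ J) ≡ 𝟙 (J ≐ᵇ W)
      both J = trans (sym (𝟙-∧ (J ⊆ᵇ W) (U ⊆ᵇ J))) (𝟙-cong {(J ⊆ᵇ W) ∧ (U ⊆ᵇ J)} {J ≐ᵇ W}
        (λ t → let (f , g) = to (T-∧ {J ⊆ᵇ W}) t in from T-≐ᵇ (to T-⊆ᵇ f , ⊑-trans {W} W⊑U (to (T-⊆ᵇ {U}) g)))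
        (λ t → let (f , g) = to (T-≐ᵇ {J}) t in from T-∧ (from T-⊆ᵇ f , from T-⊆ᵇ (⊑-trans {U} U⊑W g))))
    ... | inj₂ (a , Wa , ¬Ua) = let (H , hyp , U⊑H) = hyperplane subW subU U⊑W Wa ¬Ua in begin
      ∑ (subspacesOf W) (λ J → 𝟙 (U ⊆ᵇ J) *ℤ möbius q (dim W ∸ dim J))
        ≡⟨ ∑-hyperplane subW hyp U⊑H (λ d → möbius q (dim W ∸ d)) ⟩
      ∑ (subspacesOf H) (λ K → 𝟙 (U ⊆ᵇ K) *ℤ (möbius q (dim W ∸ dim K) +ℤ + (q ^ (dim H ∸ dim K)) *ℤ möbius q (dim W ∸ suc (dim K))))
        ≡⟨ ∑-cong (subspacesOf H) (λ {K} i → trans (cong (𝟙 (U ⊆ᵇ K) *ℤ_) (cancel H hyp K i)) (ℤₚ.*-zeroʳ (𝟙 (U ⊆ᵇ K)))) ⟩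
      ∑ (subspacesOf H) (const 0ℤ)
        ≡⟨ ∑-0 (subspacesOf H) ⟩
      0ℤ
        ≡⟨ 𝟙-false (λ t → ¬Ua (to (T-⊆ᵇ {W}) t a Wa)) ⟨
      𝟙 (W ⊆ᵇ U) ∎
      where
      open ≡-Reasoning
      cancel : ∀ H → Hyperplane H W → ∀ K → K ∈ subspacesOf H
             → möbius q (dim W ∸ dim K) +ℤ + (q ^ (dim H ∸ dim K)) *ℤ möbius q (dim W ∸ suc (dim K)) ≡ 0ℤ
      -- Since dim K ≤ dim H, the difference dim W - dim K is a successor and the recursion of
      -- `möbius` applies.
      cancel H hyp K i
        rewrite dim-hyperplane subW hyp
              | ℕₚ.+-∸-assoc 1 (dim-mono (proj₁ (∈-subspacesOf {H} i)) (Hyperplane.sub hyp) (proj₂ (∈-subspacesOf {H} i)))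
        = ℤₚ.+-inverseˡ (+ (q ^ (dim H ∸ dim K)) *ℤ möbius q (dim H ∸ dim K))

    -- Subspaces of given dimension

    countDim : ℕ → (V → Bool) → ℤ
    countDim r W = ∑ (subspacesOf W) (λ J → 𝟙 (dim J ≡ᵇ r))

    ∑-hyperplane-dim : ∀ {H W} → IsSub W → Hyperplane H W → ∀ g → ∑ (subspacesOf W) (g ∘ dim)
      ≡ ∑ (subspacesOf H) (λ K → g (dim K) +ℤ + (q ^ (dim H ∸ dim K)) *ℤ g (suc (dim K)))
    ∑-hyperplane-dim {H} {W} subW hyp g = trans
      (∑-cong (subspacesOf W) (λ {J} i → sym (over W i (g (dim J)))))
      (trans (∑-hyperplane subW hyp (trivial-⊑ (Hyperplane.sub hyp)) g)
        (∑-cong (subspacesOf H) (λ {K} i → over H i _)))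
      where
      over : ∀ W {J} → J ∈ subspacesOf W → ∀ x → 𝟙 (trivial ⊆ᵇ J) *ℤ x ≡ x
      over W {J} i x = trans (cong (_*ℤ x) (𝟙-true (from T-⊆ᵇ (trivial-⊑ (proj₁ (∈-subspacesOf {W} i)))))) (ℤₚ.*-identityˡ x)

    -- The q-Pascal rule, with an upper index 1 + dim H.
    countDim-suc : ∀ {H W} → IsSub W → Hyperplane H W → ∀ r
                 → countDim (suc r) W ≡ countDim (suc r) H +ℤ + (q ^ (dim H ∸ r)) *ℤ countDim r H
    countDim-suc {H} {W} subW hyp r = begin
      countDim (suc r) W
        ≡⟨ ∑-hyperplane-dim subW hyp (λ d → 𝟙 (d ≡ᵇ suc r)) ⟩
      ∑ (subspacesOf H) (λ K → 𝟙 (dim K ≡ᵇ suc r) +ℤ + (q ^ (dim H ∸ dim K)) *ℤ 𝟙 (dim K ≡ᵇ r))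
        ≡⟨ ∑-cong (subspacesOf H) (λ {K} _ → cong (𝟙 (dim K ≡ᵇ suc r) +ℤ_) (level K)) ⟩
      ∑ (subspacesOf H) (λ K → 𝟙 (dim K ≡ᵇ suc r) +ℤ + (q ^ (dim H ∸ r)) *ℤ 𝟙 (dim K ≡ᵇ r))
        ≡⟨ ∑-+ (subspacesOf H) (λ K → 𝟙 (dim K ≡ᵇ suc r)) (λ K → + (q ^ (dim H ∸ r)) *ℤ 𝟙 (dim K ≡ᵇ r)) ⟩
      countDim (suc r) H +ℤ ∑ (subspacesOf H) (λ K → + (q ^ (dim H ∸ r)) *ℤ 𝟙 (dim K ≡ᵇ r))
        ≡⟨ cong (countDim (suc r) H +ℤ_) (∑-*ˡ (subspacesOf H) (+ (q ^ (dim H ∸ r))) (λ K → 𝟙 (dim K ≡ᵇ r))) ⟩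
      countDim (suc r) H +ℤ + (q ^ (dim H ∸ r)) *ℤ countDim r H ∎
      where
      open ≡-Reasoning
      level : ∀ K → + (q ^ (dim H ∸ dim K)) *ℤ 𝟙 (dim K ≡ᵇ r) ≡ + (q ^ (dim H ∸ r)) *ℤ 𝟙 (dim K ≡ᵇ r)
      level K = trans (ℤₚ.*-comm _ (𝟙 (dim K ≡ᵇ r))) (trans
        (𝟙-guard (dim K ≡ᵇ r) (+ (q ^ (dim H ∸ dim K))) (+ (q ^ (dim H ∸ r))) (λ t → cong (λ z → + (q ^ (dim H ∸ z))) (to (T-≡ᵇ {dim K} {r}) t)))
        (ℤₚ.*-comm (𝟙 (dim K ≡ᵇ r)) _))

    -- A lift has positive dimension, so only subspaces inside the hyperplane contribute.
    countDim-0 : ∀ {H W} → IsSub W → Hyperplane H W → countDim 0 W ≡ countDim 0 H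
    countDim-0 {H} {W} subW hyp = trans (∑-hyperplane-dim subW hyp (λ d → 𝟙 (d ≡ᵇ 0)))
      (∑-cong (subspacesOf H) (λ {K} _ → trans (cong (𝟙 (dim K ≡ᵇ 0) +ℤ_) (ℤₚ.*-zeroʳ (+ (q ^ (dim H ∸ dim K))))) (ℤₚ.+-identityʳ _)))

    countDim-trivial : ∀ {W} → IsSub W → W ⊑ trivial → ∀ r → countDim r W ≡ 𝟙 (0 ≡ᵇ r)
    countDim-trivial {W} subW W⊑ r = begin
      countDim r W
        ≡⟨ ∑-filterᵇ (_⊆ᵇ W) subspaces (λ J → 𝟙 (dim J ≡ᵇ r)) ⟩
      ∑ subspaces (λ J → 𝟙 (J ⊆ᵇ W) *ℤ 𝟙 (dim J ≡ᵇ r))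
        ≡⟨ ∑-cong subspaces (λ {J} i → cong (_*ℤ 𝟙 (dim J ≡ᵇ r)) (𝟙-cong {J ⊆ᵇ W} {J ≐ᵇ trivial}
             (λ t → from T-≐ᵇ (⊑-trans {J} (to T-⊆ᵇ t) W⊑ , trivial-⊑ (∈-subspaces i)))
             (λ t → from T-⊆ᵇ (⊑-trans {J} (proj₁ (to (T-≐ᵇ {J}) t)) (trivial-⊑ subW))))) ⟩
      ∑ subspaces (λ J → 𝟙 (J ≐ᵇ trivial) *ℤ 𝟙 (dim J ≡ᵇ r))
        ≡⟨ ∑-once subspaces (λ J → J ≐ᵇ trivial) (λ J → 𝟙 (dim J ≡ᵇ r)) (subspaces-once trivial-sub)
             (λ {J} _ t → let (f , g) = to (T-≐ᵇ {J}) t in cong (λ z → 𝟙 (z ≡ᵇ r)) (trans (dim-cong f g) dim-trivial)) ⟩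
      𝟙 (0 ≡ᵇ r) ∎
      where open ≡-Reasoning

    -- Induction on the dimension. With P = `gaussProd q h r`, Q = q^(h-r) and R = q^(r+1), the
    -- Pascal rule multiplied by the denominators becomes P(Q - 1) + Q(R - 1)P = P(QR - 1), and QR =
    -- q^(h+1).
    countDim-gaussProd : ∀ w {W} → IsSub W → dim W ≡ w → ∀ r → countDim r W *ℤ + gaussProd q r r ≡ + gaussProd q w r
    countDim-gaussProd zero {W} subW dim≡0 r =
      trans (cong (_*ℤ + gaussProd q r r) (countDim-trivial subW (⊑-card (trivial-⊑ subW) small) r)) (base r)
      where
      small : cardinality W ≤ cardinality trivial
      small = ℕₚ.≤-reflexive (trans (card-dim subW) (trans (cong (q ^_) dim≡0) (sym card-trivial)))
      base : ∀ r → 𝟙 (0 ≡ᵇ r) *ℤ + gaussProd q r r ≡ + gaussProd q 0 r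
      base zero    = refl
      base (suc r) = refl
    countDim-gaussProd (suc h) {W} subW dim≡ r with separate W trivial
    ... | inj₁ W⊑ = contradiction (trans (sym dim≡) (trans (dim-cong W⊑ (trivial-⊑ subW)) dim-trivial)) λ ()
    ... | inj₂ (a , Wa , ¬a) with hyperplane subW trivial-sub (trivial-⊑ subW) Wa ¬a
    ... | H , hyp , _ = step r
      where
      open ≡-Reasoning
      open Hyperplane hyp using (sub)
      dimH : dim H ≡ h
      dimH = ℕₚ.suc-injective (trans (sym (dim-hyperplane subW hyp)) dim≡)
      IH : ∀ r → countDim r H *ℤ + gaussProd q r r ≡ + gaussProd q h r
      IH = countDim-gaussProd h sub dimH
      expand : ∀ A Q B X Y → (A +ℤ Q *ℤ B) *ℤ (X *ℤ Y) ≡ A *ℤ (X *ℤ Y) +ℤ Q *ℤ X *ℤ (B *ℤ Y)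
      expand = solve-∀
      collect : ∀ P Q R → P *ℤ (Q -ℤ 1ℤ) +ℤ Q *ℤ (R -ℤ 1ℤ) *ℤ P ≡ P *ℤ (Q *ℤ R -ℤ 1ℤ)
      collect = solve-∀
      q^-1 : ∀ d → + (q ^ d ∸ 1) ≡ + (q ^ d) -ℤ 1ℤ
      q^-1 d = +[m∸n] (ℕₚ.m^n>0 q d)
      finish : ∀ r → + gaussProd q h r *ℤ (+ (q ^ (h ∸ r)) *ℤ + (q ^ suc r) -ℤ 1ℤ) ≡ + gaussProd q (suc h) (suc r)
      finish r with r ≤? h
      ... | yes r≤h = begin
        + gaussProd q h r *ℤ (+ (q ^ (h ∸ r)) *ℤ + (q ^ suc r) -ℤ 1ℤ)
          ≡⟨ cong (λ z → + gaussProd q h r *ℤ (z -ℤ 1ℤ)) (trans (sym (ℤₚ.pos-* (q ^ (h ∸ r)) (q ^ suc r)))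
               (cong +_ (trans (sym (ℕₚ.^-distribˡ-+-* q (h ∸ r) (suc r))) (cong (q ^_) (trans (ℕₚ.+-suc (h ∸ r) r) (cong suc (ℕₚ.m∸n+n≡m r≤h))))))) ⟩
        + gaussProd q h r *ℤ (+ (q ^ suc h) -ℤ 1ℤ)
          ≡⟨ cong (+ gaussProd q h r *ℤ_) (q^-1 (suc h)) ⟨
        + gaussProd q h r *ℤ + (q ^ suc h ∸ 1)
          ≡⟨ ℤₚ.*-comm (+ gaussProd q h r) (+ (q ^ suc h ∸ 1)) ⟩
        + (q ^ suc h ∸ 1) *ℤ + gaussProd q h r
          ≡⟨ ℤₚ.pos-* (q ^ suc h ∸ 1) (gaussProd q h r) ⟨
        + gaussProd q (suc h) (suc r) ∎
      -- For r > h the exponent h - r is truncated and QR is not q^(h+1), but then P = 0.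
      ... | no r≰h rewrite gaussProd-< q {h} {r} (ℕₚ.≰⇒> r≰h) = cong +_ (sym (ℕₚ.*-zeroʳ (q ^ suc h ∸ 1)))
      step : ∀ r → countDim r W *ℤ + gaussProd q r r ≡ + gaussProd q (suc h) r
      step zero    = trans (cong (_*ℤ 1ℤ) (countDim-0 subW hyp)) (IH 0)
      step (suc r) = begin
        countDim (suc r) W *ℤ + gaussProd q (suc r) (suc r)
          ≡⟨ cong₂ _*ℤ_ (countDim-suc subW hyp r) (ℤₚ.pos-* (q ^ suc r ∸ 1) (gaussProd q r r)) ⟩
        (countDim (suc r) H +ℤ + (q ^ (dim H ∸ r)) *ℤ countDim r H) *ℤ (+ (q ^ suc r ∸ 1) *ℤ + gaussProd q r r)
          ≡⟨ expand (countDim (suc r) H) (+ (q ^ (dim H ∸ r))) (countDim r H) (+ (q ^ suc r ∸ 1)) (+ gaussProd q r r) ⟩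
        countDim (suc r) H *ℤ (+ (q ^ suc r ∸ 1) *ℤ + gaussProd q r r) +ℤ + (q ^ (dim H ∸ r)) *ℤ + (q ^ suc r ∸ 1) *ℤ (countDim r H *ℤ + gaussProd q r r)
          ≡⟨ cong₂ (λ x y → x +ℤ + (q ^ (dim H ∸ r)) *ℤ + (q ^ suc r ∸ 1) *ℤ y)
               (trans (cong (countDim (suc r) H *ℤ_) (sym (ℤₚ.pos-* (q ^ suc r ∸ 1) (gaussProd q r r)))) (IH (suc r))) (IH r) ⟩
        + gaussProd q h (suc r) +ℤ + (q ^ (dim H ∸ r)) *ℤ + (q ^ suc r ∸ 1) *ℤ + gaussProd q h r
          ≡⟨ cong₂ (λ x y → x +ℤ + (q ^ (y ∸ r)) *ℤ + (q ^ suc r ∸ 1) *ℤ + gaussProd q h r)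
               (trans (cong +_ (gaussProd-suc q h r)) (ℤₚ.pos-* (gaussProd q h r) (q ^ (h ∸ r) ∸ 1))) dimH ⟩
        + gaussProd q h r *ℤ + (q ^ (h ∸ r) ∸ 1) +ℤ + (q ^ (h ∸ r)) *ℤ + (q ^ suc r ∸ 1) *ℤ + gaussProd q h r
          ≡⟨ cong₂ (λ x y → + gaussProd q h r *ℤ x +ℤ + (q ^ (h ∸ r)) *ℤ y *ℤ + gaussProd q h r) (q^-1 (h ∸ r)) (q^-1 (suc r)) ⟩
        + gaussProd q h r *ℤ (+ (q ^ (h ∸ r)) -ℤ 1ℤ) +ℤ + (q ^ (h ∸ r)) *ℤ (+ (q ^ suc r) -ℤ 1ℤ) *ℤ + gaussProd q h r
          ≡⟨ collect (+ gaussProd q h r) (+ (q ^ (h ∸ r))) (+ (q ^ suc r)) ⟩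
        + gaussProd q h r *ℤ (+ (q ^ (h ∸ r)) *ℤ + (q ^ suc r) -ℤ 1ℤ)
          ≡⟨ finish r ⟩
        + gaussProd q (suc h) (suc r) ∎

    countDim-gauss : ∀ {W} → IsSub W → ∀ r → countDim r W ≡ + gauss q (dim W) r
    countDim-gauss {W} subW r = trans (sym count≡) (cong +_ (sym (gauss-unique 1<q (dim W) r count (ℤₚ.+-injective (begin
      + (count * gaussProd q r r)        ≡⟨ ℤₚ.pos-* count (gaussProd q r r) ⟩
      + count *ℤ + gaussProd q r r       ≡⟨ cong (_*ℤ + gaussProd q r r) count≡ ⟩
      countDim r W *ℤ + gaussProd q r r  ≡⟨ countDim-gaussProd (dim W) subW refl r ⟩
      + gaussProd q (dim W) r ∎)))))
      where
      open ≡-Reasoning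
      count : ℕ
      count = length (filterᵇ (λ J → dim J ≡ᵇ r) (subspacesOf W))
      count≡ : + count ≡ countDim r W
      count≡ = length-filterᵇ (λ J → dim J ≡ᵇ r) (subspacesOf W)

-- Coordinate spaces and their enumerations

module _ {A : Set} {k : ℕ} {xs : List A} {ys : List (Vec A k)} where

  private
    asProduct : ∀ xs → concatMap (λ x → map (x ∷_) ys) xs ≡ cartesianProductWith _∷_ xs ys
    asProduct []       = refl
    asProduct (x ∷ xs) = cong (map (x ∷_) ys ++_) (asProduct xs)

  ∷-complete : (∀ x → x ∈ xs) → (∀ v → v ∈ ys) → ∀ v → v ∈ concatMap (λ x → map (x ∷_) ys) xs
  ∷-complete cx cy (x ∷ v) = subst (x ∷ v ∈_) (sym (asProduct xs)) (∈-cartesianProductWith⁺ _∷_ (cx x) (cy v))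

  ∷-unique : Unique xs → Unique ys → Unique (concatMap (λ x → map (x ∷_) ys) xs)
  ∷-unique ux uy = subst Unique (sym (asProduct xs)) (cartesianProductWith⁺ _∷_ Vecₚ.∷-injective ux uy)

-- The enumeration inside Fnm and the sign inside μ are local to Defs; unification recovers them.
module LocalDefinitions {q : ℕ} (𝔽 : FiniteField q) where
  open RankMetric 𝔽
  open FiniteField 𝔽 using (F)

  mutual
    columns-tail : (n m : ℕ) → List (Vec (Vec F n) m)
    columns-tail = _

    elems-suc : ∀ n m → FinSpace.elems (Fnm n (suc m)) ≡ concatMap (λ x → map (x ∷_) (columns-tail n m)) (vecs n)
    elems-suc n m = refl

  mutual
    columns : (n : ℕ) → ℕ → (k : ℕ) → List (Vec (Vec F n) k)
    columns = _

    -- The local enumeration depends on the full column count and on its own length, which are tied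
    -- as `suc m` and `m` in `columns-tail`. Abstracting `suc m` makes them independent, as an
    -- induction on the length requires.
    columns-tail≡ : ∀ n m → columns-tail n m ≡ columns n (suc m) m
    columns-tail≡ n m with suc m
    ... | _ = refl

  mutual
    sign : (n m : ℕ) (J W : Vec F n → Bool) → ℕ → ℤ
    sign = _

    -- Abstracting ∣_∣ keeps the sign visible to unification under the unfolded integer product.
    μ≡sign : ∀ n m J W → let d = dimE n m W ∸ dimE n m J in μ n m J W ≡ sign n m J W d *ℤ + (q ^ (d choose 2))
    μ≡sign n m J W with ∣_∣ | dimE n m W ∸ dimE n m J
    ... | _ | _ = refl

  -- The identity binom(d+1, 2) = d + binom(d, 2) turns the closed form into the recursion of
  -- `möbius`.
  μ≡möbius : ∀ n m J W → μ n m J W ≡ möbius q (dimE n m W ∸ dimE n m J)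
  μ≡möbius n m J W = trans (μ≡sign n m J W) (signed (dimE n m W ∸ dimE n m J))
    where
    open ≡-Reasoning
    signed : ∀ d → sign n m J W d *ℤ + (q ^ (d choose 2)) ≡ möbius q d
    signed zero    = refl
    signed (suc d) = begin
      -ℤ s *ℤ + (q ^ (suc d choose 2))
        ≡⟨ cong (λ z → -ℤ s *ℤ + (q ^ z)) (trans (sym (nCk+nC[k+1]≡[n+1]C[k+1] d 1)) (cong (_+ d choose 2) (nC1≡n d))) ⟩
      -ℤ s *ℤ + (q ^ (d + d choose 2))
        ≡⟨ cong (-ℤ s *ℤ_) (trans (cong +_ (ℕₚ.^-distribˡ-+-* q d (d choose 2))) (ℤₚ.pos-* (q ^ d) (q ^ (d choose 2)))) ⟩
      -ℤ s *ℤ (+ (q ^ d) *ℤ + (q ^ (d choose 2)))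
        ≡⟨ regroup s (+ (q ^ d)) (+ (q ^ (d choose 2))) ⟩
      -ℤ (+ (q ^ d) *ℤ (s *ℤ + (q ^ (d choose 2))))
        ≡⟨ cong (λ z → -ℤ (+ (q ^ d) *ℤ z)) (signed d) ⟩
      möbius q (suc d) ∎
      where
      s : ℤ
      s = sign n m J W d
      regroup : ∀ x y z → -ℤ x *ℤ (y *ℤ z) ≡ -ℤ (y *ℤ (x *ℤ z))
      regroup = solve-∀

module Spaces {q : ℕ} (𝔽 : FiniteField q) where
  open FieldTheory 𝔽
  open RankMetric 𝔽
  open LocalDefinitions 𝔽

  line : FinSpace
  line = record { V = F ; eqV = _≟F_ ; elems = elements ; zeroV = 0# ; addV = _+F_ ; smul = _*F_ }

  line-isVectorSpace : IsVectorSpace line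
  line-isVectorSpace = record
    { add-assoc = +F-assoc ; add-comm = +F-comm ; add-identityʳ = +F-identityʳ
    ; smul-distribˡ = *F-distribˡ ; smul-distribʳ = λ c d u → *F-distribʳ u c d
    ; smul-assoc = *F-assoc ; smul-identity = *F-identityˡ ; smul-zeroˡ = *F-zeroˡ
    ; complete = completeF ; unique = uniqueF }

  -- `Fn n` is a power of `line` and `Fnm n m` a power of `Fn n`, so the axioms are checked once,
  -- coordinatewise. The enumeration is a parameter, as the two are listed by different functions.
  power : (X : FinSpace) (k : ℕ) → List (Vec (FinSpace.V X) k) → FinSpace
  power X k es = record
    { V = Vec V k ; eqV = Vecₚ.≡-dec eqV ; elems = es ; zeroV = Vec.replicate k zeroV
    ; addV = Vec.zipWith addV ; smul = λ c → Vec.map (smul c) }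
    where open FinSpace X

  power-isVectorSpace : ∀ {X} → IsVectorSpace X → ∀ {k es} → (∀ v → v ∈ es) → Unique es → IsVectorSpace (power X k es)
  power-isVectorSpace {X} isVS {k} es-complete es-unique = record
    { add-assoc = Vecₚ.zipWith-assoc add-assoc
    ; add-comm = Vecₚ.zipWith-comm add-comm
    ; add-identityʳ = Vecₚ.zipWith-identityʳ add-identityʳ
    ; smul-distribˡ = distribˡ
    ; smul-distribʳ = distribʳ
    ; smul-assoc = λ c d u → trans (Vecₚ.map-cong (smul-assoc c d) u) (Vecₚ.map-∘ (smul c) (smul d) u)
    ; smul-identity = λ u → trans (Vecₚ.map-cong smul-identity u) (Vecₚ.map-id u)
    ; smul-zeroˡ = λ u → trans (Vecₚ.map-cong smul-zeroˡ u) (Vecₚ.map-const u zeroV)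
    ; complete = es-complete ; unique = es-unique }
    where
    open FinSpace X
    open IsVectorSpace isVS
    distribˡ : ∀ {k} c (u v : Vec V k)
             → Vec.map (smul c) (Vec.zipWith addV u v) ≡ Vec.zipWith addV (Vec.map (smul c) u) (Vec.map (smul c) v)
    distribˡ c []      []      = refl
    distribˡ c (x ∷ u) (y ∷ v) = cong₂ _∷_ (smul-distribˡ c x y) (distribˡ c u v)
    distribʳ : ∀ {k} c d (u : Vec V k)
             → Vec.map (smul (c +F d)) u ≡ Vec.zipWith addV (Vec.map (smul c) u) (Vec.map (smul d) u)
    distribʳ c d []      = refl
    distribʳ c d (x ∷ u) = cong₂ _∷_ (smul-distribʳ c d x) (distribʳ c d u)

  vecs-complete : ∀ n (v : Vec F n) → v ∈ vecs n
  vecs-complete zero    []      = here refl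
  vecs-complete (suc n) v = ∷-complete completeF (vecs-complete n) v

  vecs-unique : ∀ n → Unique (vecs n)
  vecs-unique zero    = [] ∷ []
  vecs-unique (suc n) = ∷-unique uniqueF (vecs-unique n)

  columns-complete : ∀ n m k (v : Vec (Vec F n) k) → v ∈ columns n m k
  columns-complete n m zero    []      = here refl
  columns-complete n m (suc k) v = ∷-complete (vecs-complete n) (columns-complete n m k) v

  columns-unique : ∀ n m k → Unique (columns n m k)
  columns-unique n m zero    = [] ∷ []
  columns-unique n m (suc k) = ∷-unique (vecs-unique n) (columns-unique n m k)

  Fn-isVectorSpace : ∀ n → IsVectorSpace (Fn n)
  Fn-isVectorSpace n = power-isVectorSpace line-isVectorSpace (vecs-complete n) (vecs-unique n)

  Fnm-isVectorSpace : ∀ n m → IsVectorSpace (Fnm n m)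
  Fnm-isVectorSpace n m = power-isVectorSpace (Fn-isVectorSpace n) (columns-complete n m m) (columns-unique n m m)

module Codes {q : ℕ} (𝔽 : FiniteField q) (n m : ℕ) where
  open FieldTheory 𝔽
  open RankMetric 𝔽
  open LocalDefinitions 𝔽
  open Spaces 𝔽

  module E = VectorSpace (Fn n) (Fn-isVectorSpace n)
  module M = VectorSpace (Fnm n m) (Fnm-isVectorSpace n m)
  module E∙ = FinSpace (Fn n)
  module M∙ = FinSpace (Fnm n m)

  -- The dot product

  infix 21 _·_
  -- `dot` with the length free, so that its laws follow by induction on vectors.
  _·_ : ∀ {k} → Vec F k → Vec F k → F
  u · v = Vec.foldr _ _+F_ 0# (Vec.zipWith _*F_ u v)

  ·-comm : ∀ {k} (u v : Vec F k) → u · v ≡ v · u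
  ·-comm []      []      = refl
  ·-comm (x ∷ u) (y ∷ v) = cong₂ _+F_ (*F-comm x y) (·-comm u v)

  ·-zeroʳ : ∀ {k} (u : Vec F k) → u · Vec.replicate k 0# ≡ 0#
  ·-zeroʳ []      = refl
  ·-zeroʳ (x ∷ u) = trans (cong₂ _+F_ (*F-zeroʳ x) (·-zeroʳ u)) (+F-identityʳ 0#)

  ·-distribˡ : ∀ {k} (u v w : Vec F k) → u · Vec.zipWith _+F_ v w ≡ u · v +F u · w
  ·-distribˡ []      []      []      = sym (+F-identityʳ 0#)
  ·-distribˡ (x ∷ u) (y ∷ v) (z ∷ w) = begin
    x *F (y +F z) +F u · Vec.zipWith _+F_ v w   ≡⟨ cong₂ _+F_ (*F-distribˡ x y z) (·-distribˡ u v w) ⟩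
    (x *F y +F x *F z) +F (u · v +F u · w)      ≡⟨ +F-assoc (x *F y) _ _ ⟩
    x *F y +F (x *F z +F (u · v +F u · w))      ≡⟨ cong (x *F y +F_) (+F-assoc (x *F z) _ _) ⟨
    x *F y +F ((x *F z +F u · v) +F u · w)      ≡⟨ cong (λ t → x *F y +F (t +F u · w)) (+F-comm (x *F z) (u · v)) ⟩
    x *F y +F ((u · v +F x *F z) +F u · w)      ≡⟨ cong (x *F y +F_) (+F-assoc (u · v) _ _) ⟩
    x *F y +F (u · v +F (x *F z +F u · w))      ≡⟨ +F-assoc (x *F y) _ _ ⟨
    (x *F y +F u · v) +F (x *F z +F u · w) ∎
    where open ≡-Reasoning

  ·-smul : ∀ {k} c (u v : Vec F k) → u · Vec.map (c *F_) v ≡ c *F (u · v)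
  ·-smul c []      []      = sym (*F-zeroʳ c)
  ·-smul c (x ∷ u) (y ∷ v) = trans
    (cong₂ _+F_ (trans (sym (*F-assoc x c y)) (trans (cong (_*F y) (*F-comm x c)) (*F-assoc c x y))) (·-smul c u v))
    (sym (*F-distribˡ c (x *F y) (u · v)))

  -- Testing against (1, 0, ..., 0) gives the first coordinate; testing against (0, u) passes the
  -- hypothesis on to the rest.
  nondegenerate : ∀ {k} (v : Vec F k) → (∀ u → u · v ≡ 0#) → v ≡ Vec.replicate k 0#
  nondegenerate []      _ = refl
  nondegenerate {suc k} (y ∷ v) h = cong₂ _∷_
    (begin
      y                                      ≡⟨ *F-identityˡ y ⟨
      1# *F y                                ≡⟨ +F-identityʳ _ ⟨
      1# *F y +F 0#                          ≡⟨ cong (1# *F y +F_) (trans (·-comm _ v) (·-zeroʳ v)) ⟨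
      1# *F y +F (Vec.replicate k 0# · v)    ≡⟨ h (1# ∷ Vec.replicate k 0#) ⟩
      0# ∎)
    (nondegenerate v λ u → begin
      u · v               ≡⟨ +F-identityʳ _ ⟨
      u · v +F 0#         ≡⟨ +F-comm _ 0# ⟩
      0# +F u · v         ≡⟨ cong (_+F u · v) (*F-zeroˡ y) ⟨
      0# *F y +F u · v    ≡⟨ h (0# ∷ u) ⟩
      0# ∎)
    where open ≡-Reasoning

  -- Orthogonal complements

  infixl 9 _⊥
  _⊥ : (E∙.V → Bool) → (E∙.V → Bool)
  _⊥ = perp n m

  T-perp : ∀ {J v} → T ((J ⊥) v) ⇔ (∀ u → T (J u) → u · v ≡ 0#)
  T-perp {J} {v} = mk⇔
    (λ t u Ju → toWitness {a? = u · v ≟F 0#} (to (T-⇒ {J u}) (to (T-allᵇ {xs = vecs n}) t (vecs-complete n u)) Ju))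
    (λ h → from (T-allᵇ {xs = vecs n}) (λ {u} _ → from (T-⇒ {J u}) (λ Ju → fromWitness {a? = u · v ≟F 0#} (h u Ju))))

  perp-sub : ∀ J → E.IsSub (J ⊥)
  perp-sub J .E.has-0 = from (T-perp {J}) (λ u _ → ·-zeroʳ u)
  perp-sub J .E.has-+ {v} {w} tv tw = from (T-perp {J}) (λ u Ju →
    trans (·-distribˡ u v w) (trans (cong₂ _+F_ (to (T-perp {J}) tv u Ju) (to (T-perp {J}) tw u Ju)) (+F-identityʳ 0#)))
  perp-sub J .E.has-· c {v} tv = from (T-perp {J}) (λ u Ju →
    trans (·-smul c u v) (trans (cong (c *F_) (to (T-perp {J}) tv u Ju)) (*F-zeroʳ c)))

  -- With `⊞-least`, orthogonality to `v` on a hyperplane and at one further point spreads to the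
  -- whole space.
  annihilator : ∀ v → E.IsSub (λ u → ⌊ u · v ≟F 0# ⌋)
  annihilator v .E.has-0 = fromWitness (trans (·-comm _ v) (·-zeroʳ v))
  annihilator v .E.has-+ {u} {w} tu tw = fromWitness (begin
    Vec.zipWith _+F_ u w · v ≡⟨ ·-comm _ v ⟩
    v · Vec.zipWith _+F_ u w ≡⟨ ·-distribˡ v u w ⟩
    v · u +F v · w           ≡⟨ cong₂ _+F_ (trans (·-comm v u) (toWitness tu)) (trans (·-comm v w) (toWitness tw)) ⟩
    0# +F 0#                 ≡⟨ +F-identityʳ 0# ⟩
    0# ∎)
    where open ≡-Reasoning
  annihilator v .E.has-· c {u} tu = fromWitness
    (trans (·-comm _ v) (trans (·-smul c v u) (trans (cong (c *F_) (trans (·-comm v u) (toWitness tu))) (*F-zeroʳ c))))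

  perp-anti : ∀ {J K} → J E.⊑ K → K ⊥ E.⊑ J ⊥
  perp-anti {J} {K} h v t = from (T-perp {J}) (λ u Ju → to (T-perp {K}) t u (h u Ju))

  -- Take b in H⊥ but not in W⊥, if there is one. As W = H + <a>, a·b is not 0, so any v in H⊥
  -- becomes orthogonal to `a`, hence to `W`, after adding a multiple of b. Thus H⊥ lies in W⊥ +
  -- <b>.
  perp-hyperplane : ∀ {H W} → E.IsSub W → E.Hyperplane H W → cardE n m (H ⊥) ≤ q * cardE n m (W ⊥)
  perp-hyperplane {H} {W} subW hyp with E.separate (H ⊥) (W ⊥)
  ... | inj₁ H⊥⊑W⊥ = ℕₚ.≤-trans (E.card-mono H⊥⊑W⊥) (ℕₚ.m≤n*m (cardE n m (W ⊥)) q)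
  ... | inj₂ (b , H⊥b , ¬W⊥b) = subst (cardE n m (H ⊥) ≤_) (E.card-⊞ (perp-sub W) ¬W⊥b) (E.card-mono covered)
    where
    open E.Hyperplane hyp renaming (point to a)
    ab≢0 : a · b ≢ 0#
    ab≢0 e = ¬W⊥b (from (T-perp {W}) (λ u Wu → toWitness {a? = u · b ≟F 0#}
      (E.⊞-least {H} (annihilator b) (λ w Hw → fromWitness (to (T-perp {H}) H⊥b w Hw)) (fromWitness e) u
        (E.hyperplane-spans subW hyp inside off u Wu))))
    covered : H ⊥ E.⊑ (W ⊥) E.⊞ b
    covered v H⊥v = from (E.T-⊞ {W ⊥}) (c , from (T-perp {W}) (λ u Wu → toWitness {a? = u · w ≟F 0#}
      (E.⊞-least {H} (annihilator w)
        (λ x Hx → fromWitness (to (T-perp {H}) (E.has-+ (perp-sub H) H⊥v (E.has-· (perp-sub H) c H⊥b)) x Hx))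
        (fromWitness aw≡0) u (E.hyperplane-spans subW hyp inside off u Wu))))
      where
      open ≡-Reasoning
      d c : F
      d = proj₁ (inverse (a · b) ab≢0)
      -- The scalar -(a·v)/(a·b) is the one that makes a·(v + c·b) vanish.
      c = -F (a · v) *F d
      w : E∙.V
      w = E∙.addV v (E∙.smul c b)
      aw≡0 : a · w ≡ 0#
      aw≡0 = begin
        a · w ≡⟨ ·-distribˡ a v (E∙.smul c b) ⟩
        a · v +F a · E∙.smul c b ≡⟨ cong (a · v +F_) (·-smul c a b) ⟩
        a · v +F (-F (a · v) *F d) *F (a · b) ≡⟨ cong (a · v +F_) (*F-assoc (-F (a · v)) d (a · b)) ⟩
        a · v +F -F (a · v) *F (d *F (a · b)) ≡⟨ cong (λ z → a · v +F -F (a · v) *F z) (trans (*F-comm d (a · b)) (proj₂ (inverse (a · b) ab≢0))) ⟩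
        a · v +F -F (a · v) *F 1# ≡⟨ cong (a · v +F_) (*F-identityʳ (-F (a · v))) ⟩
        a · v +F -F (a · v) ≡⟨ -F-inverseʳ (a · v) ⟩
        0# ∎

  -- Along a chain of hyperplanes from `W` down to `U`, each step divides the first factor by q and
  -- enlarges the second by at most q.
  perp-card-mono : ∀ {U W} → E.IsSub U → E.IsSub W → U E.⊑ W
                 → cardE n m U * cardE n m (U ⊥) ≤ cardE n m W * cardE n m (W ⊥)
  perp-card-mono {U} subU subW U⊑W = go subW U⊑W (<-wellFounded _)
    where
    go : ∀ {W} → E.IsSub W → U E.⊑ W → Acc _<_ (cardE n m W)
       → cardE n m U * cardE n m (U ⊥) ≤ cardE n m W * cardE n m (W ⊥)
    go {W} subW U⊑W (acc rec) with E.separate W U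
    ... | inj₁ W⊑U = ℕₚ.*-mono-≤ (E.card-mono U⊑W) (E.card-mono (perp-anti {W} W⊑U))
    ... | inj₂ (a , Wa , ¬Ua) with E.hyperplane subW subU U⊑W Wa ¬Ua
    ... | H , hyp , U⊑H = begin
      cardE n m U * cardE n m (U ⊥)
        ≤⟨ go sub U⊑H (rec (count-mono-< H W (λ {x} → below x) (vecs-complete n point) off inside)) ⟩
      cardE n m H * cardE n m (H ⊥)
        ≤⟨ ℕₚ.*-monoʳ-≤ (cardE n m H) (perp-hyperplane subW hyp) ⟩
      cardE n m H * (q * cardE n m (W ⊥))
        ≡⟨ ℕₚ.*-assoc (cardE n m H) q _ ⟨
      cardE n m H * q * cardE n m (W ⊥)
        ≡⟨ cong (_* cardE n m (W ⊥)) (trans (ℕₚ.*-comm (cardE n m H) q) (sym card≡)) ⟩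
      cardE n m W * cardE n m (W ⊥) ∎
      where
      open ℕₚ.≤-Reasoning
      open E.Hyperplane hyp

  full : E∙.V → Bool
  full = Efull n m

  full-sub : E.IsSub full
  full-sub = record { has-0 = tt ; has-+ = λ _ _ → tt ; has-· = λ _ _ → tt }

  perp-full : full ⊥ E.⊑ E.trivial
  perp-full v t = fromWitness (nondegenerate v (λ u → to (T-perp {full}) t u tt))

  -- The product |J||J⊥| is monotone in J and has the same value |E| at both extremes.
  perp-card : ∀ {J} → E.IsSub J → cardE n m J * cardE n m (J ⊥) ≡ cardE n m full
  perp-card {J} subJ = ℕₚ.≤-antisym
    (begin
      cardE n m J * cardE n m (J ⊥)        ≤⟨ perp-card-mono subJ full-sub (λ _ _ → tt) ⟩
      cardE n m full * cardE n m (full ⊥)  ≤⟨ ℕₚ.*-monoʳ-≤ (cardE n m full) (E.card-mono perp-full) ⟩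
      cardE n m full * cardE n m E.trivial ≡⟨ cong (cardE n m full *_) E.card-trivial ⟩
      cardE n m full * 1                   ≡⟨ ℕₚ.*-identityʳ _ ⟩
      cardE n m full ∎)
    (begin
      cardE n m full                                ≤⟨ E.card-mono (λ v _ → from (T-perp {E.trivial}) (λ u t →
                                                         trans (cong (_· v) (toWitness t)) (trans (·-comm _ v) (·-zeroʳ v)))) ⟩
      cardE n m (E.trivial ⊥)                       ≡⟨ ℕₚ.*-identityˡ _ ⟨
      1 * cardE n m (E.trivial ⊥)                   ≡⟨ cong (_* cardE n m (E.trivial ⊥)) E.card-trivial ⟨
      cardE n m E.trivial * cardE n m (E.trivial ⊥) ≤⟨ perp-card-mono E.trivial-sub subJ (E.trivial-⊑ subJ) ⟩
      cardE n m J * cardE n m (J ⊥) ∎)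
    where open ℕₚ.≤-Reasoning

  ⊑-perp-perp : ∀ J → J E.⊑ J ⊥ ⊥
  ⊑-perp-perp J v Jv = from (T-perp {J ⊥}) (λ u t → trans (·-comm u v) (to (T-perp {J}) t v Jv))

  -- Both |J||J⊥| and |J⊥||J⊥⊥| equal |E|, so the inclusion of J in J⊥⊥ is one between sets of the
  -- same cardinality.
  perp-perp-⊑ : ∀ {J} → E.IsSub J → J ⊥ ⊥ E.⊑ J
  perp-perp-⊑ {J} subJ = E.⊑-card (⊑-perp-perp J) (ℕₚ.≤-reflexive
    (ℕₚ.*-cancelˡ-≡ _ _ (cardE n m (J ⊥)) {{>-nonZero (E.card-pos (perp-sub J))}}
      (trans (perp-card (perp-sub J)) (trans (sym (perp-card subJ)) (ℕₚ.*-comm (cardE n m J) _)))))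

  -- Supports and subcodes

  suppIn-mono : ∀ {J K} → J E.⊑ K → ∀ M → T (suppIn n m M J) → T (suppIn n m M K)
  suppIn-mono h M t = from (T-allᵇ {xs = Vec.toList M}) (λ i → h _ (to (T-allᵇ {xs = Vec.toList M}) t i))

  suppIn-zero : ∀ {J} → E.IsSub J → ∀ k → T (allᵇ J (Vec.toList (Vec.replicate k E∙.zeroV)))
  suppIn-zero sub zero    = tt
  suppIn-zero sub (suc k) = from T-∧ (E.has-0 sub , suppIn-zero sub k)

  suppIn-+ : ∀ {J} → E.IsSub J → ∀ {k} (M N : Vec E∙.V k) → T (allᵇ J (Vec.toList M)) → T (allᵇ J (Vec.toList N))
           → T (allᵇ J (Vec.toList (Vec.zipWith E∙.addV M N)))
  suppIn-+ sub []      []      _ _ = tt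
  suppIn-+ {J} sub (u ∷ M) (v ∷ N) s t = let (Ju , s′) = to (T-∧ {J u}) s ; (Jv , t′) = to (T-∧ {J v}) t in
    from T-∧ (E.has-+ sub Ju Jv , suppIn-+ sub M N s′ t′)

  suppIn-· : ∀ {J} → E.IsSub J → ∀ c {k} (M : Vec E∙.V k) → T (allᵇ J (Vec.toList M))
           → T (allᵇ J (Vec.toList (Vec.map (E∙.smul c) M)))
  suppIn-· sub c []      _ = tt
  suppIn-· {J} sub c (u ∷ M) t = let (Ju , t′) = to (T-∧ {J u}) t in from T-∧ (E.has-· sub c Ju , suppIn-· sub c M t′)

  restrict-sub : ∀ {C J} → M.IsSub C → E.IsSub J → M.IsSub (restrict n m C J)
  restrict-sub subC subJ .M.has-0 = from T-∧ (M.has-0 subC , suppIn-zero subJ m)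
  restrict-sub {C} subC subJ .M.has-+ {u} {v} s t = let (Cu , s′) = to (T-∧ {C u}) s ; (Cv , t′) = to (T-∧ {C v}) t in
    from T-∧ (M.has-+ subC Cu Cv , suppIn-+ subJ u v s′ t′)
  restrict-sub {C} subC subJ .M.has-· c {v} t = let (Cv , t′) = to (T-∧ {C v}) t in
    from T-∧ (M.has-· subC c Cv , suppIn-· subJ c v t′)

  restrict-mono : ∀ C {J K} → J E.⊑ K → restrict n m C J M.⊑ restrict n m C K
  restrict-mono C {J} h v t = let (Cv , t′) = to (T-∧ {C v}) t in from T-∧ (Cv , suppIn-mono {J} h v t′)

  restrict-trivial : ∀ C {J} → J E.⊑ E.trivial → restrict n m C J M.⊑ M.trivial
  restrict-trivial C {J} h v t = fromWitness (zero-columns v (suppIn-mono {J} h v (proj₂ (to (T-∧ {C v}) t))))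
    where
    zero-columns : ∀ {k} (v : Vec E∙.V k) → T (allᵇ E.trivial (Vec.toList v)) → v ≡ Vec.replicate k E∙.zeroV
    zero-columns []      _ = refl
    zero-columns (u ∷ v) t = let (tu , tv) = to (T-∧ {E.trivial u}) t in cong₂ _∷_ (toWitness tu) (zero-columns v tv)

  SuppBound : (M∙.V → Bool) → (E∙.V → Bool) → Set
  SuppBound D S = ∀ N → T (D N) → T (suppIn n m N S)

  T-Supp : ∀ {D v} → T (Supp n m D v) ⇔ (∀ {S} → S ∈ subspacesE n m → SuppBound D S → T (S v))
  T-Supp {D} {v} = mk⇔
    (λ t {S} i h → to (T-⇒ {allᵇ (λ N → not (D N) ∨ suppIn n m N S) M∙.elems}) (to (T-allᵇ {xs = subspacesE n m}) t i)
      (from (T-allᵇ {xs = M∙.elems}) (λ {N} _ → from (T-⇒ {D N}) (h N))))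
    (λ h → from (T-allᵇ {xs = subspacesE n m}) (λ {S} i → from (T-⇒ {allᵇ (λ N → not (D N) ∨ suppIn n m N S) M∙.elems})
      (λ t → h i (λ N → to (T-⇒ {D N}) (to (T-allᵇ {xs = M∙.elems}) t (columns-complete n m m N))))))

  Supp-sub : ∀ D → E.IsSub (Supp n m D)
  Supp-sub D .E.has-0 = from (T-Supp {D}) (λ i _ → E.has-0 (E.∈-subspaces i))
  Supp-sub D .E.has-+ s t = from (T-Supp {D}) (λ i h → E.has-+ (E.∈-subspaces i) (to (T-Supp {D}) s i h) (to (T-Supp {D}) t i h))
  Supp-sub D .E.has-· c t = from (T-Supp {D}) (λ i h → E.has-· (E.∈-subspaces i) c (to (T-Supp {D}) t i h))

  -- `Supp` is an intersection over listed predicates, and `J` may agree with a listed `S` only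
  -- pointwise; the bound is therefore carried over to `S`.
  Supp-⊑ : ∀ {D J} → E.IsSub J → (Supp n m D E.⊑ J) ⇔ SuppBound D J
  Supp-⊑ {D} {J} subJ = mk⇔
    (λ h N DN → suppIn-mono {Supp n m D} h N (from (T-allᵇ {xs = Vec.toList N}) (λ i → from (T-Supp {D}) (λ _ bound →
      to (T-allᵇ {xs = Vec.toList N}) (bound N DN) i))))
    (λ bound v t →
      let (S , i , S≐J) = ∑-exists (subspacesE n m) (λ S → _≐E_ n m S J) (λ e → 1≢0 (trans (sym (E.subspaces-once subJ)) e))
          (S⊑J , J⊑S) = to (E.T-≐ᵇ {S}) S≐J
      in S⊑J v (to (T-Supp {D}) t i (λ N DN → suppIn-mono {J} J⊑S N (bound N DN))))
    where
    1≢0 : 1ℤ ≢ 0ℤ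
    1≢0 ()

  ⊑-restrict : ∀ {C D J} → E.IsSub J → (D M.⊑ restrict n m C J) ⇔ (D M.⊑ C × Supp n m D E.⊑ J)
  ⊑-restrict {C} {D} {J} subJ = mk⇔
    (λ h → (λ N DN → proj₁ (to (T-∧ {C N}) (h N DN)))
         , from (Supp-⊑ {D} subJ) (λ N DN → proj₂ (to (T-∧ {C N}) (h N DN))))
    (λ (f , g) N DN → from T-∧ (f N DN , to (Supp-⊑ {D} subJ) g N DN))

  -- Sums over subcodes

  module _ {C : M∙.V → Bool} (subC : M.IsSub C) where

    subcode : ℕ → (M∙.V → Bool) → ℤ
    subcode r D = 𝟙 (_⊆M_ n m D C) *ℤ 𝟙 (dimM n m D ≡ᵇ r)

    A≡∑ : ∀ r W → + A n m r C W ≡ ∑ (subspacesM n m) (λ D → subcode r D *ℤ 𝟙 (_≐E_ n m (Supp n m D) W))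
    A≡∑ r W = trans (length-filterᵇ (λ D → (_⊆M_ n m D C) ∧ (dimM n m D ≡ᵇ r) ∧ (_≐E_ n m (Supp n m D) W)) (subspacesM n m))
      (∑-cong (subspacesM n m) (λ {D} _ → begin
        𝟙 ((_⊆M_ n m D C) ∧ (dimM n m D ≡ᵇ r) ∧ (_≐E_ n m (Supp n m D) W))
          ≡⟨ 𝟙-∧ (_⊆M_ n m D C) ((dimM n m D ≡ᵇ r) ∧ (_≐E_ n m (Supp n m D) W)) ⟩
        𝟙 (_⊆M_ n m D C) *ℤ 𝟙 ((dimM n m D ≡ᵇ r) ∧ (_≐E_ n m (Supp n m D) W))
          ≡⟨ cong (𝟙 (_⊆M_ n m D C) *ℤ_) (𝟙-∧ (dimM n m D ≡ᵇ r) (_≐E_ n m (Supp n m D) W)) ⟩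
        𝟙 (_⊆M_ n m D C) *ℤ (𝟙 (dimM n m D ≡ᵇ r) *ℤ 𝟙 (_≐E_ n m (Supp n m D) W))
          ≡⟨ ℤₚ.*-assoc (𝟙 (_⊆M_ n m D C)) (𝟙 (dimM n m D ≡ᵇ r)) (𝟙 (_≐E_ n m (Supp n m D) W)) ⟨
        subcode r D *ℤ 𝟙 (_≐E_ n m (Supp n m D) W) ∎))
      where open ≡-Reasoning

    countDim-restrict : ∀ r {J} → E.IsSub J
      → M.countDim r (restrict n m C J) ≡ ∑ (subspacesM n m) (λ D → subcode r D *ℤ 𝟙 (_⊆E_ n m (Supp n m D) J))
    countDim-restrict r {J} subJ = trans
      (∑-filterᵇ (λ D → _⊆M_ n m D (restrict n m C J)) (subspacesM n m) (λ D → 𝟙 (dimM n m D ≡ᵇ r)))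
      (∑-cong (subspacesM n m) (λ {D} _ → begin
        𝟙 (_⊆M_ n m D (restrict n m C J)) *ℤ 𝟙 (dimM n m D ≡ᵇ r)
          ≡⟨ cong (_*ℤ 𝟙 (dimM n m D ≡ᵇ r)) (𝟙-cong {_⊆M_ n m D (restrict n m C J)} {(_⊆M_ n m D C) ∧ (_⊆E_ n m (Supp n m D) J)}
               (λ t → let (f , g) = to (⊑-restrict {C} {D} subJ) (to M.T-⊆ᵇ t) in from T-∧ (from M.T-⊆ᵇ f , from E.T-⊆ᵇ g))
               (λ t → let (f , g) = to (T-∧ {_⊆M_ n m D C}) t in
                  from M.T-⊆ᵇ (from (⊑-restrict {C} {D} subJ) (to M.T-⊆ᵇ f , to E.T-⊆ᵇ g)))) ⟩
        𝟙 ((_⊆M_ n m D C) ∧ (_⊆E_ n m (Supp n m D) J)) *ℤ 𝟙 (dimM n m D ≡ᵇ r)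
          ≡⟨ cong (_*ℤ 𝟙 (dimM n m D ≡ᵇ r)) (𝟙-∧ (_⊆M_ n m D C) (_⊆E_ n m (Supp n m D) J)) ⟩
        𝟙 (_⊆M_ n m D C) *ℤ 𝟙 (_⊆E_ n m (Supp n m D) J) *ℤ 𝟙 (dimM n m D ≡ᵇ r)
          ≡⟨ swap (𝟙 (_⊆M_ n m D C)) (𝟙 (_⊆E_ n m (Supp n m D) J)) (𝟙 (dimM n m D ≡ᵇ r)) ⟩
        subcode r D *ℤ 𝟙 (_⊆E_ n m (Supp n m D) J) ∎))
      where
      open ≡-Reasoning
      swap : ∀ x y z → x *ℤ y *ℤ z ≡ x *ℤ z *ℤ y
      swap = solve-∀

    -- C(J⊥) ≤ C, so the truncated subtraction in `ρ` loses nothing and can be undone.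
    dim∸ρ : ∀ {J} → E.IsSub J → dimM n m C ∸ ρ n m C J ≡ dimM n m (restrict n m C (J ⊥))
    dim∸ρ {J} subJ = ℕₚ.m∸[m∸n]≡n (M.dim-mono (restrict-sub subC (perp-sub J)) subC (λ N t → proj₁ (to (T-∧ {C N}) t)))

    -- E⊥ = 0, and only the zero matrix has its support in 0.
    ρ-full : ρ n m C full ≡ dimM n m C
    ρ-full = cong (dimM n m C ∸_) (trans
      (M.dim-cong (restrict-trivial C perp-full) (M.trivial-⊑ (restrict-sub subC (perp-sub full)))) M.dim-trivial)

    ρ-perp : ∀ {J} → E.IsSub J → ρ n m C full ∸ ρ n m C (J ⊥) ≡ dimM n m (restrict n m C J)
    ρ-perp {J} subJ = trans (cong (_∸ ρ n m C (J ⊥)) ρ-full) (trans (dim∸ρ (perp-sub J))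
      (M.dim-cong (restrict-mono C (perp-perp-⊑ subJ)) (restrict-mono C (⊑-perp-perp J))))

    -- The support need not lie in `W`. If it does not, no J ≤ W contains it and both sides are 0.
    ∑-möbius-Supp : ∀ D {W} → E.IsSub W
      → ∑ (subspacesOfE n m W) (λ J → 𝟙 (_⊆E_ n m (Supp n m D) J) *ℤ möbius q (dimE n m W ∸ dimE n m J))
      ≡ 𝟙 (_≐E_ n m (Supp n m D) W)
    ∑-möbius-Supp D {W} subW with E.separate (Supp n m D) W
    ... | inj₁ S⊑W = trans (E.∑-möbius (Supp-sub D) subW S⊑W)
      (𝟙-cong {_⊆E_ n m W (Supp n m D)} {_≐E_ n m (Supp n m D) W}
        (λ t → from T-∧ (from E.T-⊆ᵇ S⊑W , t)) (λ t → proj₂ (to (T-∧ {_⊆E_ n m (Supp n m D) W}) t)))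
    ... | inj₂ (a , Sa , ¬Wa) = trans
      (∑-cong (subspacesOfE n m W) (λ {J} i → cong (_*ℤ möbius q (dimE n m W ∸ dimE n m J))
        (𝟙-false (λ t → ¬Wa (proj₂ (E.∈-subspacesOf {W} i) a (to (E.T-⊆ᵇ {Supp n m D}) t a Sa))))))
      (trans (∑-0 (subspacesOfE n m W))
        (sym (𝟙-false (λ t → ¬Wa (proj₁ (to (E.T-≐ᵇ {Supp n m D}) t) a Sa)))))

    ∑-≐ : ∀ {S} → E.IsSub S → ∀ P → ∑ (subspacesOfE n m P) (λ W → 𝟙 (_≐E_ n m S W)) ≡ 𝟙 (_⊆E_ n m S P)
    ∑-≐ {S} subS P = begin
      ∑ (subspacesOfE n m P) (λ W → 𝟙 (_≐E_ n m S W))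
        ≡⟨ ∑-filterᵇ (λ W → _⊆E_ n m W P) (subspacesE n m) (λ W → 𝟙 (_≐E_ n m S W)) ⟩
      ∑ (subspacesE n m) (λ W → 𝟙 (_⊆E_ n m W P) *ℤ 𝟙 (_≐E_ n m S W))
        ≡⟨ ∑-cong (subspacesE n m) (λ {W} _ → trans (ℤₚ.*-comm (𝟙 (_⊆E_ n m W P)) (𝟙 (_≐E_ n m S W)))
             (cong (_*ℤ 𝟙 (_⊆E_ n m W P)) (𝟙-cong {_≐E_ n m S W} {_≐E_ n m W S} (flip S W) (flip W S)))) ⟩
      ∑ (subspacesE n m) (λ W → 𝟙 (_≐E_ n m W S) *ℤ 𝟙 (_⊆E_ n m W P))
        ≡⟨ ∑-once (subspacesE n m) (λ W → _≐E_ n m W S) (λ W → 𝟙 (_⊆E_ n m W P)) (E.subspaces-once subS)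
             (λ {W} _ t → let (f , g) = to (E.T-≐ᵇ {W}) t in 𝟙-cong {_⊆E_ n m W P} {_⊆E_ n m S P}
               (λ w → from E.T-⊆ᵇ (E.⊑-trans {S} g (to E.T-⊆ᵇ w))) (λ s → from E.T-⊆ᵇ (E.⊑-trans {W} f (to E.T-⊆ᵇ s)))) ⟩
      𝟙 (_⊆E_ n m S P) ∎
      where
      open ≡-Reasoning
      flip : ∀ S W → T (_≐E_ n m S W) → T (_≐E_ n m W S)
      flip S W t = let (f , g) = to (T-∧ {_⊆E_ n m S W}) t in from T-∧ (g , f)

    -- Möbius inversion takes place on indicators: [Supp D = W] is expanded into the tests Supp D ≤
    -- J, and after the exchange of sums the inner sum counts the r-dimensional subspaces of C(J).
    supports-from-ρ : ∀ r {W} → E.IsSub W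
      → + A n m r C W ≡ ∑ (subspacesOfE n m W) (λ J → μ n m J W *ℤ + gauss q (ρ n m C full ∸ ρ n m C (J ⊥)) r)
    supports-from-ρ r {W} subW = begin
      + A n m r C W
        ≡⟨ A≡∑ r W ⟩
      ∑ (subspacesM n m) (λ D → subcode r D *ℤ 𝟙 (_≐E_ n m (Supp n m D) W))
        ≡⟨ ∑-cong (subspacesM n m) (λ {D} _ → cong (subcode r D *ℤ_) (sym (∑-möbius-Supp D subW))) ⟩
      ∑ (subspacesM n m) (λ D → subcode r D *ℤ ∑ (subspacesOfE n m W) (λ J → 𝟙 (_⊆E_ n m (Supp n m D) J) *ℤ mö J))
        ≡⟨ ∑-cong (subspacesM n m) (λ {D} _ → trans
             (sym (∑-*ˡ (subspacesOfE n m W) (subcode r D) (λ J → 𝟙 (_⊆E_ n m (Supp n m D) J) *ℤ mö J)))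
             (∑-cong (subspacesOfE n m W) (λ {J} _ → rotate (subcode r D) (𝟙 (_⊆E_ n m (Supp n m D) J)) (mö J)))) ⟩
      ∑ (subspacesM n m) (λ D → ∑ (subspacesOfE n m W) (λ J → mö J *ℤ (subcode r D *ℤ 𝟙 (_⊆E_ n m (Supp n m D) J))))
        ≡⟨ ∑-swap (subspacesM n m) (subspacesOfE n m W) (λ D J → mö J *ℤ (subcode r D *ℤ 𝟙 (_⊆E_ n m (Supp n m D) J))) ⟩
      ∑ (subspacesOfE n m W) (λ J → ∑ (subspacesM n m) (λ D → mö J *ℤ (subcode r D *ℤ 𝟙 (_⊆E_ n m (Supp n m D) J))))
        ≡⟨ ∑-cong (subspacesOfE n m W) (λ {J} i → trans
             (∑-*ˡ (subspacesM n m) (mö J) (λ D → subcode r D *ℤ 𝟙 (_⊆E_ n m (Supp n m D) J)))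
             (cong₂ _*ℤ_ (sym (μ≡möbius n m J W)) (count i))) ⟩
      ∑ (subspacesOfE n m W) (λ J → μ n m J W *ℤ + gauss q (ρ n m C full ∸ ρ n m C (J ⊥)) r) ∎
      where
      open ≡-Reasoning
      mö : (E∙.V → Bool) → ℤ
      mö J = möbius q (dimE n m W ∸ dimE n m J)
      rotate : ∀ x y z → x *ℤ (y *ℤ z) ≡ z *ℤ (x *ℤ y)
      rotate = solve-∀
      count : ∀ {J} → J ∈ subspacesOfE n m W
            → ∑ (subspacesM n m) (λ D → subcode r D *ℤ 𝟙 (_⊆E_ n m (Supp n m D) J)) ≡ + gauss q (ρ n m C full ∸ ρ n m C (J ⊥)) r
      count {J} i = let subJ = proj₁ (E.∈-subspacesOf {W} i) in begin
        ∑ (subspacesM n m) (λ D → subcode r D *ℤ 𝟙 (_⊆E_ n m (Supp n m D) J)) ≡⟨ countDim-restrict r subJ ⟨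
        M.countDim r (restrict n m C J)                                       ≡⟨ M.countDim-gauss (restrict-sub subC subJ) r ⟩
        + gauss q (dimM n m (restrict n m C J)) r                             ≡⟨ cong (λ d → + gauss q d r) (ρ-perp subJ) ⟨
        + gauss q (ρ n m C full ∸ ρ n m C (J ⊥)) r ∎

    -- A subcode D with Supp D ≤ P is counted by exactly one W ≤ P, its own support.
    ∑-A : ∀ r {P} → E.IsSub P → + sumℕ (map (A n m r C) (subspacesOfE n m P)) ≡ M.countDim r (restrict n m C P)
    ∑-A r {P} subP = begin
      + sumℕ (map (A n m r C) (subspacesOfE n m P))
        ≡⟨ pos-sum (subspacesOfE n m P) (A n m r C) ⟩
      ∑ (subspacesOfE n m P) (λ W → + A n m r C W)
        ≡⟨ ∑-cong (subspacesOfE n m P) (λ {W} _ → A≡∑ r W) ⟩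
      ∑ (subspacesOfE n m P) (λ W → ∑ (subspacesM n m) (λ D → subcode r D *ℤ 𝟙 (_≐E_ n m (Supp n m D) W)))
        ≡⟨ ∑-swap (subspacesOfE n m P) (subspacesM n m) (λ W D → subcode r D *ℤ 𝟙 (_≐E_ n m (Supp n m D) W)) ⟩
      ∑ (subspacesM n m) (λ D → ∑ (subspacesOfE n m P) (λ W → subcode r D *ℤ 𝟙 (_≐E_ n m (Supp n m D) W)))
        ≡⟨ ∑-cong (subspacesM n m) (λ {D} _ → trans
             (∑-*ˡ (subspacesOfE n m P) (subcode r D) (λ W → 𝟙 (_≐E_ n m (Supp n m D) W)))
             (cong (subcode r D *ℤ_) (∑-≐ (Supp-sub D) P))) ⟩
      ∑ (subspacesM n m) (λ D → subcode r D *ℤ 𝟙 (_⊆E_ n m (Supp n m D) P))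
        ≡⟨ countDim-restrict r subP ⟨
      M.countDim r (restrict n m C P) ∎
      where
      open ≡-Reasoning
      pos-sum : ∀ {B : Set} (xs : List B) f → + sumℕ (map f xs) ≡ ∑ xs (+_ ∘ f)
      pos-sum []       f = refl
      pos-sum (x ∷ xs) f = cong (+ f x +ℤ_) (pos-sum xs f)

    -- The 1 accounts for the zero matrix, and q - 1 is the number of nonzero matrices on a line of
    -- C(J⊥). Both q - 1 and q^d - 1 enter as Gaussian products with r = 1.
    ρ-from-supports : ∀ {J} → E.IsSub J
      → q ^ (dimM n m C ∸ ρ n m C J) ≡ 1 + (q ∸ 1) * sumℕ (map (A n m 1 C) (subspacesOfE n m (J ⊥)))
    ρ-from-supports {J} subJ = begin
      q ^ (dimM n m C ∸ ρ n m C J) ≡⟨ cong (q ^_) (dim∸ρ subJ) ⟩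
      q ^ d                        ≡⟨ ℕₚ.m+[n∸m]≡n (ℕₚ.m^n>0 q d) ⟨
      1 + (q ^ d ∸ 1)              ≡⟨ cong suc (ℤₚ.+-injective lines) ⟨
      1 + (q ∸ 1) * s ∎
      where
      open ≡-Reasoning
      d s : ℕ
      d = dimM n m (restrict n m C (J ⊥))
      s = sumℕ (map (A n m 1 C) (subspacesOfE n m (J ⊥)))
      lines : + ((q ∸ 1) * s) ≡ + (q ^ d ∸ 1)
      lines = begin
        + ((q ∸ 1) * s)                ≡⟨ cong +_ (ℕₚ.*-comm (q ∸ 1) s) ⟩
        + (s * (q ∸ 1))                ≡⟨ cong (λ z → + (s * z)) (trans (ℕₚ.*-identityʳ _) (cong (_∸ 1) (ℕₚ.*-identityʳ q))) ⟨
        + (s * gaussProd q 1 1)        ≡⟨ ℤₚ.pos-* s (gaussProd q 1 1) ⟩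
        + s *ℤ + gaussProd q 1 1       ≡⟨ cong (_*ℤ + gaussProd q 1 1) (∑-A 1 (perp-sub J)) ⟩
        M.countDim 1 (restrict n m C (J ⊥)) *ℤ + gaussProd q 1 1
                                       ≡⟨ M.countDim-gaussProd d (restrict-sub subC (perp-sub J)) refl 1 ⟩
        + gaussProd q d 1              ≡⟨ cong +_ (ℕₚ.*-identityʳ (q ^ d ∸ 1)) ⟩
        + (q ^ d ∸ 1) ∎

theorem3p21 : (q : ℕ) (𝔽 : FiniteField q) (n m : ℕ)
    → let open RankMetric 𝔽 in
    (C : Mat n m → Bool) → T (isSubspaceM n m C)
    → ((r : ℕ) → r ≤ dimM n m C
    → (W : Vec (FiniteField.F 𝔽) n → Bool) → T (isSubspaceE n m W)
    → + A n m r C W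
    ≡ sumℤ (map (λ J → μ n m J W *ℤ (+ gauss q (ρ n m C (Efull n m) ∸ ρ n m C (perp n m J)) r))
    (subspacesOfE n m W)))
    × ((J : Vec (FiniteField.F 𝔽) n → Bool) → T (isSubspaceE n m J)
    → q ^ (dimM n m C ∸ ρ n m C J)
    ≡ 1 + (q ∸ 1) * sumℕ (map (A n m 1 C) (subspacesOfE n m (perp n m J))))
theorem3p21 q 𝔽 n m C isC =
  (λ r _ W isW → supports-from-ρ subC r (to E.T-isSubspace isW)) ,
  (λ J isJ → ρ-from-supports subC (to E.T-isSubspace isJ))
  where
  open Codes 𝔽 n m
  subC : M.IsSub C
  subC = to M.T-isSubspace isC
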